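{- There exist $d\in\mathbb{N}$, constants $\delta=\delta(d)\in(0,1)$ and $\epsilon=\epsilon(d)\in(0,1)$, and a sequence $(G_N)_{N\in\mathbb{N}}$ of graphs of maximum degree at most $d$ and of increasing order, such that for every $N\in\mathbb{N}$ the graph $G_N$ is $\delta$-locally Hamiltonian on $\mathcal{C}_d$ and $\epsilon$-far from being Hamiltonian.
   Context: All graphs are finite, simple and undirected. $\mathcal{C}_d$ denotes the class of all graphs of maximum degree at most $d$. A Hamiltonian cycle is a cycle visiting every vertex exactly once; a graph is Hamiltonian if it has one. For $S\subseteq V(G)$, $N_G(S)$ is the closed neighbourhood $S\cup\{v: v \text{ adjacent to some } w\in S\}$, and $G[X]$ is the induced subgraph on $X$. A graph $G\in\mathcal{C}_d$ is $\epsilon$-far from being Hamiltonian if for every set $E$ of 2-element subsets of $V(G)$ with $|E|\le \epsilon d|V(G)|$, the graph $(V(G),E(G)\triangle E)$ is not Hamiltonian. For a graph class $\mathcal{C}$ and $\delta\in(0,1]$, a graph $G\in\mathcal{C}$ is $\delta$-locally Hamiltonian on $\mathcal{C}$ if for every $S\subseteq V(G)$ with $|S|\le\delta|V(G)|$ there exist a Hamiltonian graph $H\in\mathcal{C}$ with $|V(H)|=|V(G)|$, a set $T\subseteq V(H)$, and an isomorphism from $G[N_G(S)]$ to $H[N_H(T)]$ mapping $S$ onto $T$. -}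

module Defs where

open import Data.Bool using (Bool; true; false; _∧_; _∨_; _xor_; if_then_else_)
open import Data.Nat as ℕ using (ℕ; zero; suc)
open import Data.Nat.DivMod using (_mod_)
open import Data.Integer using (+_)
open import Data.Rational as ℚ using (ℚ; _/_)
open import Data.Fin using (Fin; toℕ)
open import Data.Fin.Subset using (Subset; _∈_; ∣_∣)
open import Data.Vec using (tabulate; lookup)
open import Data.List using (List; allFin; map)
open import Data.Nat.ListAction using (sum)
open import Data.Bool.ListAction using (any)
open import Data.Product using (Σ; Σ-syntax; _×_; proj₁)
open import Data.Empty using (⊥)
open import Relation.Nullary using (¬_)
open import Relation.Binary.PropositionalEquality using (_≡_)
open import Function.Bundles using (_⤖_; _⇔_; Bijection)

record Graph : Set where
  field
    order  : ℕ
    adj    : Fin order → Fin order → Bool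
    irrefl : ∀ v → adj v v ≡ false
    sym    : ∀ v w → adj v w ≡ adj w v
open Graph public

degree : (G : Graph) → Fin (order G) → ℕ
degree G v = ∣ tabulate (adj G v) ∣

InC : ℕ → Graph → Set
InC d G = ∀ v → degree G v ℕ.≤ d

next : ∀ {n} → Fin (suc n) → Fin (suc n)
next {n} i = suc (toℕ i) mod (suc n)

HamCycleOn : (n : ℕ) → (Fin n → Fin n → Bool) → Set
HamCycleOn zero    a = ⊥
HamCycleOn (suc m) a =
  (3 ℕ.≤ suc m) ×
  Σ[ σ ∈ Bijection (≡-setoid (Fin (suc m))) (≡-setoid (Fin (suc m))) ]
    (∀ i → a (Bijection.to σ i) (Bijection.to σ (next i)) ≡ true)
  where open import Relation.Binary.PropositionalEquality using () renaming (setoid to ≡-setoid)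

Hamiltonian : Graph → Set
Hamiltonian G = HamCycleOn (order G) (adj G)

ℕtoℚ : ℕ → ℚ
ℕtoℚ k = + k / 1

-- A set E of 2-element subsets of Fin n, given as an irreflexive symmetric
-- Bool-valued relation (E v w ≡ true iff {v,w} ∈ E).
record PairSet (n : ℕ) : Set where
  field
    mem     : Fin n → Fin n → Bool
    irreflE : ∀ v → mem v v ≡ false
    symE    : ∀ v w → mem v w ≡ mem w v
open PairSet public

-- |E| = number of pairs {v,w} in E, counted once via v < w
size : ∀ {n} → PairSet n → ℕ
size {n} E = sum (map (λ v → ∣ tabulate (λ w → mem E v w ∧ (toℕ v ℕ.<ᵇ toℕ w)) ∣) (allFin n))

flip : (G : Graph) → PairSet (order G) → Graph
flip G E = record
  { order  = order G
  ; adj    = λ v w → adj G v w xor mem E v w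
  ; irrefl = λ v → irr v
  ; sym    = λ v w → sy v w
  }
  where
    open import Relation.Binary.PropositionalEquality using (cong₂)
    open import Relation.Binary.PropositionalEquality using (trans)
    irr : ∀ v → (adj G v v xor mem E v v) ≡ false
    irr v = trans (cong₂ _xor_ (irrefl G v) (irreflE E v)) refl′
      where open import Relation.Binary.PropositionalEquality using () renaming (refl to refl′)
    sy : ∀ v w → (adj G v w xor mem E v w) ≡ (adj G w v xor mem E w v)
    sy v w = cong₂ _xor_ (Graph.sym G v w) (symE E v w)

FarFromHam : ℚ → ℕ → Graph → Set
FarFromHam ε d G =
  (E : PairSet (order G)) →
  ℕtoℚ (size E) ℚ.≤ ε ℚ.* ℕtoℚ d ℚ.* ℕtoℚ (order G) →
  ¬ Hamiltonian (flip G E)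

N : (G : Graph) → Subset (order G) → Subset (order G)
N G S = tabulate (λ v → lookup S v ∨ any (λ w → lookup S w ∧ adj G w v) (allFin (order G)))

Vtx : (G : Graph) → Subset (order G) → Set
Vtx G X = Σ (Fin (order G)) (λ v → v ∈ X)

IsoNbhd : (G : Graph) (S : Subset (order G)) (H : Graph) (T : Subset (order H)) → Set
IsoNbhd G S H T =
  Σ[ f ∈ Vtx G (N G S) ⤖ Vtx H (N H T) ]
    ((∀ x y → adj G (proj₁ x) (proj₁ y) ≡ adj H (proj₁ (Bijection.to f x)) (proj₁ (Bijection.to f y)))
    × (∀ x → (proj₁ x ∈ S) ⇔ (proj₁ (Bijection.to f x) ∈ T)))

LocallyHam : ℚ → ℕ → Graph → Set
LocallyHam δ d G =
  (S : Subset (order G)) →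
  ℕtoℚ ∣ S ∣ ℚ.≤ δ ℚ.* ℕtoℚ (order G) →
  Σ[ H ∈ Graph ] Σ[ eq ∈ order H ≡ order G ]
    (InC d H × Hamiltonian H ×
     Σ[ T ∈ Subset (order H) ] IsoNbhd G S H T)

{-# OPTIONS --safe #-}
-- A graph G on 6m vertices: a cycle on 2m of them, and 4m independent vertices
-- each joined to the ends of four cycle edges.  Since the independent vertices
-- outnumber the others by 2m, every Hamiltonian cycle on the vertex set has 2m
-- steps between independent vertices, so G is far from Hamiltonian.
-- The incidence between independent vertices and cycle edges is chosen (by a
-- union bound) such that every small set of independent vertices contains one
-- that is incident to a cycle edge to which no other member of the set is.
-- Removing such vertices one at a time matches any small set of independent
-- vertices into the cycle edges.  Given S, insert the independent vertices near
-- S into the cycle edges matched to them, and all the other ones, in arbitrary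
-- order, into a single edge away from S.  This Hamiltonian cycle uses new edges
-- only away from S, and H is G together with them.
module Submission where

open import Data.Bool using (Bool; true; false; T; _∧_; _∨_; not; if_then_else_)
import Data.Bool as Bool
open import Data.Bool.ListAction using (any)
open import Data.Bool.Properties as Bool using (∨-comm; ∨-zeroʳ)
open import Data.Empty using (⊥-elim)
open import Data.Fin as Fin using (Fin; zero; suc; toℕ; fromℕ<; quotient; combine)
import Data.Fin.Properties as Fin
open import Data.Fin.Subset using (Subset; ∣_∣; inside; outside)
open import Data.Fin.Subset.Properties using (∣p∣≤n)
open import Data.Integer as ℤ using (+<+) renaming (+_ to pos)
import Data.Integer.Properties as ℤ
open import Data.List as List using (List; []; _∷_; _++_; length)
open import Data.List.Membership.Propositional using (_∈_)
open import Data.List.Membership.Propositional.Properties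
  using (∈-map⁺; ∈-map⁻; ∈-++⁺ˡ; ∈-++⁺ʳ; ∈-++⁻; ∈-cartesianProductWith⁺;
         ∈-cartesianProductWith⁻; ∈-concat⁺′; ∈-tabulate⁺; ∈-allFin)
import Data.List.Properties as List
open import Data.List.Relation.Unary.Any as Any using (here; there)
open import Data.List.Relation.Unary.Any.Properties using (lookup-index)
open import Data.Nat
open import Data.Nat.Coprimality as Coprimality using (1-coprimeTo)
open import Data.Nat.DivMod
open import Data.Nat.ListAction renaming (sum to sumᴸ)
open import Data.Nat.ListAction.Properties renaming (sum-++ to sumᴸ-++)
open import Data.Nat.Properties
open import Data.Nat.Tactic.RingSolver using (solve-∀)
open import Data.Product using (Σ-syntax; ∃; ∃-syntax; _×_; _,_; proj₁; proj₂)
open import Data.Rational as ℚ using (ℚ; mkℚ; 0ℚ; 1ℚ; *<*)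
import Data.Rational.Properties as ℚ
import Data.Rational.Unnormalised.Properties as ℚᵘ
open import Data.Sum using (_⊎_; inj₁; inj₂; [_,_]′)
open import Data.Vec using ([]; _∷_; tabulate; lookup)
import Data.Vec.Properties as Vec
open import Data.Vec.Properties.WithK using ([]=-irrelevant)
open import Defs hiding (N; flip; sym)
import Defs
open import Function using (_∘_; id)
open import Function.Bundles using (Bijection; mk⤖; mk⇔)
open import Relation.Binary using (tri<; tri≈; tri>)
open import Relation.Binary.PropositionalEquality
open import Relation.Nullary using (¬_; Dec; yes; no; does; contradiction; _×-dec_)
open import Algebra.Properties.Semiring.Sum +-*-semiring
  using (sum; sum-cong-≗; ∑-comm; ∑-distrib-+; *-distribˡ-sum; *-distribʳ-sum)
open import Algebra.Properties.Monoid.Sum *-1-monoid using ()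
  renaming (sum to prod; sum-cong-≗ to prod-cong)

-- Two demands on the incidence conflict: a random function has the private values that the matching
-- needs, but no bound on its fibres, while the degree has to be bounded. So the random function
-- sends the 16m slots to only m values, and its fibres are cut into blocks of at most 16
-- afterwards. Cutting makes the function finer, hence private slots stay private, and it shifts
-- values by less than m, which is why a cycle with 2m edges suffices. Four slots per independent
-- vertex serve the union bound. If s of these vertices have no private slot, every value they hit
-- is hit twice, so their 4s slots fall into at most 2s values. The chance of this is at most
-- binom(4m, s) binom(m, 2s) (2s/m)^(4s), where the exponent 4 outweighs the 1 + 2 of the two
-- choices. Probabilities appear throughout as counts with denominators cleared. The degree 36 is 2
-- (cycle) plus 2 · 16 (slots on the two cycle edges at a vertex) plus 2 (added Hamiltonian cycle).

private variable
  n k L m : ℕ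
  A : Set

-- Booleans and decidable equality

∧-elim : ∀ a {b} → a ∧ b ≡ true → a ≡ true × b ≡ true
∧-elim true h = refl , h

∧-intro : ∀ {a b} → a ≡ true → b ≡ true → a ∧ b ≡ true
∧-intro refl refl = refl

∨-elim : ∀ a {b} → a ∨ b ≡ true → a ≡ true ⊎ b ≡ true
∨-elim true  _ = inj₁ refl
∨-elim false h = inj₂ h

∨-introˡ : ∀ {a b} → a ≡ true → a ∨ b ≡ true
∨-introˡ refl = refl

∨-introʳ : ∀ {a b} → b ≡ true → a ∨ b ≡ true
∨-introʳ {a} refl = ∨-zeroʳ a

true≢false : ∀ {b : Bool} {A : Set} → b ≡ true → b ≡ false → A
true≢false refl ()

¬true⇒false : ∀ {b} → ¬ (b ≡ true) → b ≡ false
¬true⇒false {false} _ = refl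
¬true⇒false {true}  h = ⊥-elim (h refl)

bool-ext : ∀ {a b} → (a ≡ true → b ≡ true) → (b ≡ true → a ≡ true) → a ≡ b
bool-ext {true}          f _ = sym (f refl)
bool-ext {false} {false} _ _ = refl
bool-ext {false} {true}  _ g = g refl

infix 5 _==_
opaque
  _==_ : Fin n → Fin n → Bool
  i == j = does (i Fin.≟ j)

  ==⇒≡ : ∀ {i j : Fin n} → (i == j) ≡ true → i ≡ j
  ==⇒≡ {i = i} {j} h with i Fin.≟ j
  ... | yes p = p

  ≡⇒== : ∀ {i j : Fin n} → i ≡ j → (i == j) ≡ true
  ≡⇒== {i = i} refl with i Fin.≟ i
  ... | yes _ = refl
  ... | no ¬p = ⊥-elim (¬p refl)

-- Counting

𝟙 : Bool → ℕ
𝟙 b = if b then 1 else 0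

card : (Fin n → Bool) → ℕ
card p = sum (λ i → 𝟙 (p i))

∣tabulate∣≡card : (p : Fin n → Bool) → ∣ tabulate p ∣ ≡ card p
∣tabulate∣≡card {zero}  p = refl
∣tabulate∣≡card {suc n} p with p zero
... | true  = cong suc (∣tabulate∣≡card (p ∘ suc))
... | false = ∣tabulate∣≡card (p ∘ suc)

∣∣≡card : (p : Subset n) → ∣ p ∣ ≡ card (lookup p)
∣∣≡card []          = refl
∣∣≡card (true  ∷ p) = cong suc (∣∣≡card p)
∣∣≡card (false ∷ p) = ∣∣≡card p

sum-mono : {f g : Fin n → ℕ} → (∀ i → f i ≤ g i) → sum f ≤ sum g
sum-mono {zero}  h = z≤n
sum-mono {suc n} h = +-mono-≤ (h zero) (sum-mono (h ∘ suc))

term≤sum : (f : Fin n → ℕ) (i : Fin n) → f i ≤ sum f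
term≤sum f zero    = m≤m+n _ _
term≤sum f (suc i) = m≤n⇒m≤o+n (f zero) (term≤sum (f ∘ suc) i)

sum-const : ∀ n c → sum {n} (λ _ → c) ≡ n * c
sum-const zero    c = refl
sum-const (suc n) c = cong (c +_) (sum-const n c)

card-const : ∀ n → card {n} (λ _ → true) ≡ n
card-const n = trans (sum-const n 1) (*-identityʳ n)

𝟙-mono : ∀ {a b} → (a ≡ true → b ≡ true) → 𝟙 a ≤ 𝟙 b
𝟙-mono {false}         _ = z≤n
𝟙-mono {true}  {true}  _ = ≤-refl
𝟙-mono {true}  {false} h = contradiction (h refl) λ()

card-mono : (p q : Fin n → Bool) → (∀ i → p i ≡ true → q i ≡ true) → card p ≤ card q
card-mono p q h = sum-mono (λ i → 𝟙-mono (h i))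

card-cong : {p q : Fin n → Bool} → (∀ i → p i ≡ q i) → card p ≡ card q
card-cong h = sum-cong-≗ (λ i → cong 𝟙 (h i))

card-∅ : {p : Fin n → Bool} → (∀ i → p i ≡ false) → card p ≡ 0
card-∅ {n} h = trans (card-cong h) (trans (sum-const n 0) (*-zeroʳ n))

card-∨ : (p q : Fin n → Bool) → card (λ i → p i ∨ q i) ≤ card p + card q
card-∨ p q = ≤-trans (sum-mono (λ i → 𝟙-∨ (p i) (q i))) (≤-reflexive (∑-distrib-+ (𝟙 ∘ p) (𝟙 ∘ q)))
  where
  𝟙-∨ : ∀ a b → 𝟙 (a ∨ b) ≤ 𝟙 a + 𝟙 b
  𝟙-∨ true  b = s≤s z≤n
  𝟙-∨ false b = ≤-refl

0<card : (p : Fin n → Bool) {i : Fin n} → p i ≡ true → 0 < card p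
0<card p {i} h = subst (λ b → 𝟙 b ≤ card p) h (term≤sum (𝟙 ∘ p) i)

1<card : (p : Fin n → Bool) {i j : Fin n} → i ≢ j → p i ≡ true → p j ≡ true → 1 < card p
1<card p {zero}  {zero}  i≢j _ _ = ⊥-elim (i≢j refl)
1<card p {zero}  {suc j} i≢j hi hj rewrite hi = s≤s (0<card (p ∘ suc) hj)
1<card p {suc i} {zero}  i≢j hi hj rewrite hj = s≤s (0<card (p ∘ suc) hi)
1<card p {suc i} {suc j} i≢j hi hj =
  m≤n⇒m≤o+n (𝟙 (p zero)) (1<card (p ∘ suc) (i≢j ∘ cong suc) hi hj)

card-witness : (p : Fin n → Bool) → 0 < card p → ∃[ i ] p i ≡ true
card-witness {suc n} p h with p zero in eq
... | true  = zero , eq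
... | false with card-witness (p ∘ suc) h
...   | i , pi = suc i , pi

card≤1 : (p : Fin n → Bool) → (∀ i j → p i ≡ true → p j ≡ true → i ≡ j) → card p ≤ 1
card≤1 {zero}  p h = z≤n
card≤1 {suc n} p h with p zero in eq
... | false = card≤1 (p ∘ suc) (λ i j pi pj → Fin.suc-injective (h _ _ pi pj))
... | true  with card (p ∘ suc) in eq′
...   | zero  = ≤-refl
...   | suc c with card-witness (p ∘ suc) (subst (0 <_) (sym eq′) (s≤s z≤n))
...     | i , pi = contradiction (h _ _ eq pi) λ()

<ᵇ≡true⇒< : ∀ {x y} → (x <ᵇ y) ≡ true → x < y
<ᵇ≡true⇒< {x} {y} h = <ᵇ⇒< x y (subst T (sym h) _)

<⇒<ᵇ≡true : ∀ {x y} → x < y → (x <ᵇ y) ≡ true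
<⇒<ᵇ≡true {zero}  {suc y} _       = refl
<⇒<ᵇ≡true {suc x} {suc y} (s≤s h) = <⇒<ᵇ≡true h

𝟙≤1 : ∀ b → 𝟙 b ≤ 1
𝟙≤1 true  = ≤-refl
𝟙≤1 false = z≤n

sum-mono-< : {f g : Fin n → ℕ} → (∀ i → f i ≤ g i) → ∀ i → f i < g i → sum f < sum g
sum-mono-< h zero    lt = +-mono-<-≤ lt (sum-mono (h ∘ suc))
sum-mono-< h (suc i) lt = +-mono-≤-< (h zero) (sum-mono-< (h ∘ suc) i lt)

∃ᵇ : (Fin n → Bool) → Bool
∃ᵇ p = 0 <ᵇ card p

∃ᵇ-intro : (p : Fin n → Bool) {i : Fin n} → p i ≡ true → ∃ᵇ p ≡ true
∃ᵇ-intro p pi = <⇒<ᵇ≡true (0<card p pi)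

∃ᵇ-elim : (p : Fin n → Bool) → ∃ᵇ p ≡ true → ∃[ i ] p i ≡ true
∃ᵇ-elim p h = card-witness p (<ᵇ≡true⇒< h)

double-counting : (p : Fin n → Bool) (q : Fin k → Bool) (r : Fin n → Fin k → Bool) (c d : ℕ) →
  (∀ i → p i ≡ true → c ≤ card (r i)) →
  (∀ i j → p i ≡ true → r i j ≡ true → q j ≡ true) →
  (∀ j → card (λ i → p i ∧ r i j) ≤ d) →
  c * card p ≤ d * card q
double-counting p q r c d lower supp upper = begin
  c * card p                                 ≡⟨ *-distribˡ-sum c (𝟙 ∘ p) ⟩
  sum (λ i → c * 𝟙 (p i))                    ≤⟨ sum-mono row ⟩
  sum (λ i → card (λ j → p i ∧ r i j))       ≡⟨ ∑-comm (λ i j → 𝟙 (p i ∧ r i j)) ⟩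
  sum (λ j → card (λ i → p i ∧ r i j))       ≤⟨ sum-mono column ⟩
  sum (λ j → d * 𝟙 (q j))                    ≡⟨ *-distribˡ-sum d (𝟙 ∘ q) ⟨
  d * card q                                 ∎
  where
  open ≤-Reasoning
  row : ∀ i → c * 𝟙 (p i) ≤ card (λ j → p i ∧ r i j)
  row i with p i in eq
  ... | true  = ≤-trans (≤-reflexive (*-identityʳ c)) (lower i eq)
  ... | false = ≤-trans (≤-reflexive (*-zeroʳ c)) z≤n
  column : ∀ j → card (λ i → p i ∧ r i j) ≤ d * 𝟙 (q j)
  column j with q j in eq
  ... | true  = ≤-trans (upper j) (≤-reflexive (sym (*-identityʳ d)))
  ... | false = ≤-trans (≤-reflexive (card-∅ empty)) z≤n
    where
    empty : ∀ i → p i ∧ r i j ≡ false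
    empty i = ¬true⇒false λ h →
      true≢false (supp i j (proj₁ (∧-elim (p i) h)) (proj₂ (∧-elim (p i) h))) eq

card-injective : (p : Fin n → Bool) (q : Fin k → Bool) (h : Fin n → Fin k) →
  (∀ i → p i ≡ true → q (h i) ≡ true) →
  (∀ i j → p i ≡ true → p j ≡ true → h i ≡ h j → i ≡ j) →
  card p ≤ card q
card-injective p q h maps inj = subst₂ _≤_ (*-identityˡ _) (*-identityˡ _)
  (double-counting p q (λ i j → h i == j) 1 1
    (λ i _ → 0<card (h i ==_) (≡⇒== {i = h i} refl))
    (λ i j pi r → subst (λ v → q v ≡ true) (==⇒≡ r) (maps i pi))
    (λ j → card≤1 _ λ i i′ hi hi′ →
       let pi  , hi≡j  = ∧-elim (p i) hi
           pi′ , hi′≡j = ∧-elim (p i′) hi′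
       in inj i i′ pi pi′ (trans (==⇒≡ hi≡j) (sym (==⇒≡ hi′≡j)))))

-- Subsets of a given size

subsets : ∀ n → ℕ → List (Subset n)
subsets zero    zero    = [] ∷ []
subsets zero    (suc s) = []
subsets (suc n) zero    = List.map (outside ∷_) (subsets n zero)
subsets (suc n) (suc s) =
  List.map (inside ∷_) (subsets n s) ++ List.map (outside ∷_) (subsets n (suc s))

∈-subsets : (p : Subset n) → p ∈ subsets n ∣ p ∣
∈-subsets []            = here refl
∈-subsets (inside  ∷ p) = ∈-++⁺ˡ (∈-map⁺ _ (∈-subsets p))
∈-subsets (outside ∷ p) with ∣ p ∣ | ∈-subsets p
... | zero  | h = ∈-map⁺ _ h
... | suc s | h = ∈-++⁺ʳ _ (∈-map⁺ _ h)

-- The union bound lists only target sets of size exactly 2s; this pads a smaller image to that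
-- size.
superset : (p : Subset n) (t : ℕ) → ∣ p ∣ ≤ t → t ≤ n →
  ∃[ q ] q ∈ subsets n t × (∀ i → lookup p i ≡ true → lookup q i ≡ true)
superset []            zero    _       _       = [] , here refl , λ ()
superset (inside ∷ p)  (suc t) (s≤s h) (s≤s l) with superset p t h l
... | q , q∈ , p⊆q = inside ∷ q , ∈-++⁺ˡ (∈-map⁺ _ q∈) ,
                     λ { zero _ → refl ; (suc i) → p⊆q i }
superset (outside ∷ p) zero    h       l       with superset p zero h z≤n
... | q , q∈ , p⊆q = outside ∷ q , ∈-map⁺ _ q∈ , λ { (suc i) → p⊆q i }
superset {suc n} (outside ∷ p) (suc t) h (s≤s l) with suc t ≤? n
... | yes t<n with superset p (suc t) h t<n
...   | q , q∈ , p⊆q = outside ∷ q , ∈-++⁺ʳ _ (∈-map⁺ _ q∈) , λ { (suc i) → p⊆q i }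
superset {suc n} (outside ∷ p) (suc t) h (s≤s l) | no t≮n
  with superset p t (≤-trans (∣p∣≤n p) (s≤s⁻¹ (≰⇒> t≮n))) l
... | q , q∈ , p⊆q = inside ∷ q , ∈-++⁺ˡ (∈-map⁺ _ q∈) , λ { (suc i) → p⊆q i }

-- Estimates for binomial coefficients

[s+1]^j≤2s^j : ∀ s j r → j + r ≡ s → suc s ≤ 2 * suc r → suc s ^ j ≤ 2 * s ^ j
[s+1]^j≤2s^j s j r j+r≡s s<2r = *-cancelʳ-≤ _ _ (suc r) (begin
  suc s ^ j * suc r    ≤⟨ bernoulli j r j+r≡s ⟩
  s ^ j * suc s        ≤⟨ *-monoʳ-≤ (s ^ j) s<2r ⟩
  s ^ j * (2 * suc r)  ≡⟨ solve-∀′ (s ^ j) r ⟩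
  2 * s ^ j * suc r    ∎)
  where
  open ≤-Reasoning
  solve-∀′ : ∀ x r → x * (2 * suc r) ≡ 2 * x * suc r
  solve-∀′ = solve-∀
  -- Bernoulli's inequality (s/(s+1))^j ≥ 1 − j/(s+1), with r = s − j.
  bernoulli : ∀ j r → j + r ≡ s → suc s ^ j * suc r ≤ s ^ j * suc s
  bernoulli zero    r refl = ≤-refl
  bernoulli (suc j) r refl = begin
    suc s * suc s ^ j * suc r      ≡⟨ eq₁ (suc s ^ j) (suc s) r ⟩
    suc s ^ j * (suc s * suc r)    ≤⟨ *-monoʳ-≤ (suc s ^ j) (≤-trans (m≤m+n _ j) (≤-reflexive (eq₂ j r))) ⟩
    suc s ^ j * (suc (suc r) * s)  ≡⟨ *-assoc (suc s ^ j) _ _ ⟨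
    suc s ^ j * suc (suc r) * s    ≤⟨ *-monoˡ-≤ s (bernoulli j (suc r) (+-suc j r)) ⟩
    s ^ j * suc s * s              ≡⟨ eq₃ (s ^ j) s ⟩
    s * s ^ j * suc s              ∎
    where
    eq₁ : ∀ x y r → y * x * suc r ≡ x * (y * suc r)
    eq₁ = solve-∀
    eq₂ : ∀ j r → suc (suc (j + r)) * suc r + j ≡ suc (suc r) * suc (j + r)
    eq₂ = solve-∀
    eq₃ : ∀ x s → x * suc s * s ≡ s * x * suc s
    eq₃ = solve-∀

-- Elementary substitute for (1 + 1/s)^s < e: the exponent is split into two halves, and each costs
-- a factor 2. This 4 becomes the 4 in the bound on binomial coefficients.
[s+1]^s≤4s^s : ∀ s → suc s ^ s ≤ 4 * s ^ s
[s+1]^s≤4s^s s = begin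
  suc s ^ s                          ≡⟨ cong (suc s ^_) (⌊n/2⌋+⌈n/2⌉≡n s) ⟨
  suc s ^ (⌊ s /2⌋ + ⌈ s /2⌉)        ≡⟨ ^-distribˡ-+-* (suc s) ⌊ s /2⌋ ⌈ s /2⌉ ⟩
  suc s ^ ⌊ s /2⌋ * suc s ^ ⌈ s /2⌉  ≤⟨ *-mono-≤ ([s+1]^j≤2s^j s _ _ (⌊n/2⌋+⌈n/2⌉≡n s) (half s ⌈ s /2⌉ (s≤2⌈s/2⌉ s)))
                                                  ([s+1]^j≤2s^j s _ _ (trans (+-comm ⌈ s /2⌉ _) (⌊n/2⌋+⌈n/2⌉≡n s)) (half′ s)) ⟩
  2 * s ^ ⌊ s /2⌋ * (2 * s ^ ⌈ s /2⌉) ≡⟨ eq (s ^ ⌊ s /2⌋) (s ^ ⌈ s /2⌉) ⟩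
  4 * (s ^ ⌊ s /2⌋ * s ^ ⌈ s /2⌉)    ≡⟨ cong (4 *_) (^-distribˡ-+-* s ⌊ s /2⌋ ⌈ s /2⌉) ⟨
  4 * s ^ (⌊ s /2⌋ + ⌈ s /2⌉)        ≡⟨ cong (λ e → 4 * s ^ e) (⌊n/2⌋+⌈n/2⌉≡n s) ⟩
  4 * s ^ s                          ∎
  where
  open ≤-Reasoning
  eq : ∀ x y → 2 * x * (2 * y) ≡ 4 * (x * y)
  eq = solve-∀
  s≤2⌈s/2⌉ : ∀ s → s ≤ 2 * ⌈ s /2⌉
  s≤2⌈s/2⌉ zero          = z≤n
  s≤2⌈s/2⌉ (suc zero)    = s≤s z≤n
  s≤2⌈s/2⌉ (suc (suc s)) = ≤-trans (s≤s (s≤s (s≤2⌈s/2⌉ s))) (≤-reflexive (sym (*-suc 2 ⌈ s /2⌉)))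
  half : ∀ s r → s ≤ 2 * r → suc s ≤ 2 * suc r
  half s r h = ≤-trans (s≤s h) (≤-trans (n≤1+n _) (≤-reflexive (sym (*-suc 2 r))))
  half′ : ∀ s → suc s ≤ 2 * suc ⌊ s /2⌋
  half′ zero          = s≤s z≤n
  half′ (suc zero)    = s≤s (s≤s z≤n)
  half′ (suc (suc s)) = ≤-trans (s≤s (s≤s (half′ s))) (≤-reflexive (sym (*-suc 2 (suc ⌊ s /2⌋))))

-- The left side consists of the first two terms of the binomial expansion of the right side.
x^k[x+[k+1]y]≤[x+y]^[k+1] : ∀ x y k → x ^ k * (x + suc k * y) ≤ (x + y) ^ suc k
x^k[x+[k+1]y]≤[x+y]^[k+1] x y zero    = ≤-reflexive (eq x y)
  where
  eq : ∀ x y → 1 * (x + 1 * y) ≡ (x + y) * 1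
  eq = solve-∀
x^k[x+[k+1]y]≤[x+y]^[k+1] x y (suc k) = begin
  x * x ^ k * (x + suc (suc k) * y)                        ≤⟨ m≤m+n _ _ ⟩
  x * x ^ k * (x + suc (suc k) * y) + suc k * x ^ k * y * y ≡⟨ eq (x ^ k) x y k ⟩
  (x + y) * (x ^ k * (x + suc k * y))                      ≤⟨ *-monoʳ-≤ (x + y) (x^k[x+[k+1]y]≤[x+y]^[k+1] x y k) ⟩
  (x + y) * (x + y) ^ suc k                                ∎
  where
  open ≤-Reasoning
  eq : ∀ z x y k → x * z * (x + suc (suc k) * y) + suc k * z * y * y ≡ (x + y) * (z * (x + suc k * y))
  eq = solve-∀

-- binom(n, s) ≤ (4 n / s)^s
length-subsets : ∀ n s → length (subsets n s) * s ^ s ≤ (4 * n) ^ s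
length-subsets zero    zero    = ≤-refl
length-subsets zero    (suc s) = z≤n
length-subsets (suc n) zero    = ≤-trans (≤-reflexive (cong (_* 1) (List.length-map _ (subsets n zero)))) (length-subsets n zero)
length-subsets (suc n) (suc s) = begin
  length (subsets (suc n) (suc s)) * suc s ^ suc s
    ≡⟨ cong (_* suc s ^ suc s) (trans (List.length-++ (List.map (inside ∷_) (subsets n s)))
         (cong₂ _+_ (List.length-map _ (subsets n s)) (List.length-map _ (subsets n (suc s))))) ⟩
  (a + b) * (suc s * suc s ^ s)               ≡⟨ eq₁ a b (suc s) (suc s ^ s) ⟩
  a * suc s ^ s * suc s + b * (suc s * suc s ^ s)
    ≤⟨ +-mono-≤ (*-monoˡ-≤ (suc s) (*-monoʳ-≤ a ([s+1]^s≤4s^s s))) (length-subsets n (suc s)) ⟩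
  a * (4 * s ^ s) * suc s + (4 * n) ^ suc s   ≡⟨ cong (_+ (4 * n) ^ suc s) (eq₂ a (s ^ s) (suc s)) ⟩
  a * s ^ s * (suc s * 4) + (4 * n) ^ suc s   ≤⟨ +-monoˡ-≤ _ (*-monoˡ-≤ (suc s * 4) (length-subsets n s)) ⟩
  (4 * n) ^ s * (suc s * 4) + 4 * n * (4 * n) ^ s ≡⟨ eq₃ ((4 * n) ^ s) (suc s * 4) (4 * n) ⟩
  (4 * n) ^ s * (4 * n + suc s * 4)           ≤⟨ x^k[x+[k+1]y]≤[x+y]^[k+1] (4 * n) 4 s ⟩
  (4 * n + 4) ^ suc s                         ≡⟨ cong (_^ suc s) (eq₄ n) ⟩
  (4 * suc n) ^ suc s                         ∎
  where
  open ≤-Reasoning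
  a = length (subsets n s)
  b = length (subsets n (suc s))
  eq₁ : ∀ a b x y → (a + b) * (x * y) ≡ a * y * x + b * (x * y)
  eq₁ = solve-∀
  eq₂ : ∀ a x y → a * (4 * x) * y ≡ a * x * (y * 4)
  eq₂ = solve-∀
  eq₃ : ∀ x y z → x * y + z * x ≡ x * (z + y)
  eq₃ = solve-∀
  eq₄ : ∀ n → 4 * n + 4 ≡ 4 * suc n
  eq₄ = solve-∀

-- The union bound over random functions, derandomised

below-average : ∀ {m} c (g : Fin m → ℕ) → sum g < m * c → ∃[ i ] g i < c
below-average {suc m} c g h with g zero <? c
... | yes g0<c = zero , g0<c
... | no  g0≮c with below-average c (g ∘ suc)
                    (+-cancelˡ-< c _ _ (≤-<-trans (+-monoˡ-≤ _ (≮⇒≥ g0≮c)) h))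
...   | i , gi<c = suc i , gi<c

-- E stands for the event that f l satisfies E l for all l.
Event : ℕ → ℕ → Set
Event L m = Fin L → Fin m → Bool

-- The number of functions satisfying the event: its conditions on different slots are independent.
weight : Event L m → ℕ
weight E = prod (λ l → card (E l))

total : List (Event L m) → ℕ
total Es = sumᴸ (List.map weight Es)

-- The events that are still possible once the first slot has received the value `x`, as events
-- about the remaining slots.
condition : Fin m → List (Event (suc L) m) → List (Event L m)
condition x []       = []
condition x (E ∷ Es) = if E zero x then E ∘ suc ∷ condition x Es else condition x Es

∈-condition : ∀ {x} {E : Event (suc L) m} {Es} → E ∈ Es → E zero x ≡ true →
  (E ∘ suc) ∈ condition x Es
∈-condition {x = x} {Es = E ∷ Es} (here refl) h rewrite h = here refl
∈-condition {x = x} {Es = E ∷ Es} (there E∈) h with E zero x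
... | true  = there (∈-condition E∈ h)
... | false = ∈-condition E∈ h

-- The functions in each event are sorted by their first value.
total-condition : (Es : List (Event (suc L) m)) → sum (λ x → total (condition x Es)) ≡ total Es
total-condition {m = m} []       = trans (sum-const m 0) (*-zeroʳ m)
total-condition {m = m} (E ∷ Es) = begin
  sum (λ x → total (condition x (E ∷ Es)))                        ≡⟨ sum-cong-≗ split ⟩
  sum (λ x → 𝟙 (E zero x) * w + total (condition x Es))           ≡⟨ ∑-distrib-+ (λ x → 𝟙 (E zero x) * w)
                                                                                   (λ x → total (condition x Es)) ⟩
  sum (λ x → 𝟙 (E zero x) * w) + sum (λ x → total (condition x Es))
    ≡⟨ cong₂ _+_ (sym (*-distribʳ-sum w (𝟙 ∘ E zero))) (total-condition Es) ⟩
  card (E zero) * w + total Es                                    ∎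
  where
  open ≡-Reasoning
  w = weight (E ∘ suc)
  split : ∀ x → total (condition x (E ∷ Es)) ≡ 𝟙 (E zero x) * w + total (condition x Es)
  split x with E zero x
  ... | true  = cong (_+ total (condition x Es)) (sym (*-identityˡ w))
  ... | false = refl

-- Method of conditional expectations: some first value keeps the total of the conditioned events
-- below its average `m ^ L`. With no slots left the total counts the surviving events and is below
-- 1, so none survives.
avoid : ∀ L m (Es : List (Event L m)) → total Es < m ^ L →
  Σ[ f ∈ (Fin L → Fin m) ] (∀ {E} → E ∈ Es → ∃[ l ] E l (f l) ≡ false)
avoid zero    m []       h        = (λ ()) , λ ()
avoid zero    m (E ∷ Es) (s≤s ())
avoid (suc L) m Es       h
  with below-average (m ^ L) (λ x → total (condition x Es))
         (subst (_< m ^ suc L) (sym (total-condition Es)) h)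
... | x , hx with avoid L m (condition x Es) hx
...   | f , avoids = x◂f , avoids′
  where
  x◂f : Fin (suc L) → Fin m
  x◂f zero    = x
  x◂f (suc l) = f l
  avoids′ : ∀ {E} → E ∈ Es → ∃[ l ] E l (x◂f l) ≡ false
  avoids′ {E} E∈ with E zero x in eq
  ... | false = zero , eq
  ... | true  with avoids (∈-condition {E = E} E∈ eq)
  ...   | l , hl = suc l , hl

-- Slots: the slot l : Fin (n * 4) belongs to the owner quotient 4 l.

sum-quotient : ∀ n (f : Fin n → ℕ) → sum (f ∘ quotient {n} 4) ≡ 4 * sum f
sum-quotient zero    f = refl
sum-quotient (suc n) f =
  trans (cong (λ x → f zero + (f zero + (f zero + (f zero + x)))) (sum-quotient n (f ∘ suc)))
        (eq (f zero) (sum (f ∘ suc)))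
  where
  eq : ∀ x y → x + (x + (x + (x + 4 * y))) ≡ 4 * (x + y)
  eq = solve-∀

confined : Subset n → Subset m → Event (n * 4) m
confined S T l x = if lookup S (quotient 4 l) then lookup T x else true

-- Each owner in `S` has four slots, so the event has probability (|T| / m)^(4|S|) among the m^(4n)
-- functions.
weight-confined : (S : Subset n) (T : Subset m) →
  weight (confined S T) * (m ^ 4) ^ ∣ S ∣ ≡ (∣ T ∣ ^ 4) ^ ∣ S ∣ * (m ^ 4) ^ n
weight-confined {m = m} S T =
  trans (cong (_* (m ^ 4) ^ ∣ S ∣) (prod-cong card-confined)) (prod-if ∣ T ∣ S)
  where
  card-confined : ∀ l → card (confined S T l) ≡ (if lookup S (quotient 4 l) then ∣ T ∣ else m)
  card-confined l with lookup S (quotient 4 l)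
  ... | true  = sym (∣∣≡card T)
  ... | false = card-const m
  prod-if : ∀ {n} t (S : Subset n) →
    prod (λ l → if lookup S (quotient 4 l) then t else m) * (m ^ 4) ^ ∣ S ∣ ≡ (t ^ 4) ^ ∣ S ∣ * (m ^ 4) ^ n
  prod-if t []           = refl
  prod-if {suc n} t (inside ∷ S)  =
    trans (eq t (prod (λ l → if lookup S (quotient 4 l) then t else m)) (m ^ 4) ((m ^ 4) ^ ∣ S ∣))
    (trans (cong (λ x → t ^ 4 * (m ^ 4 * x)) (prod-if t S))
           (eq′ (t ^ 4) ((t ^ 4) ^ ∣ S ∣) (m ^ 4) ((m ^ 4) ^ n)))
    where
    eq : ∀ t p x y → (t * (t * (t * (t * p)))) * (x * y) ≡ t * (t * (t * (t * 1))) * (x * (p * y))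
    eq = solve-∀
    eq′ : ∀ t u x y → t * (x * (u * y)) ≡ t * u * (x * y)
    eq′ = solve-∀
  prod-if {suc n} t (outside ∷ S) =
    trans (eq m (prod (λ l → if lookup S (quotient 4 l) then t else m)) ((m ^ 4) ^ ∣ S ∣))
    (trans (cong (m ^ 4 *_) (prod-if t S)) (eq′ ((t ^ 4) ^ ∣ S ∣) (m ^ 4) ((m ^ 4) ^ n)))
    where
    eq : ∀ m p y → (m * (m * (m * (m * p)))) * y ≡ m * (m * (m * (m * 1))) * (p * y)
    eq = solve-∀
    eq′ : ∀ u x y → x * (u * y) ≡ u * (x * y)
    eq′ = solve-∀

∈-subsets⇒∣∣ : ∀ {n s} {p : Subset n} → p ∈ subsets n s → ∣ p ∣ ≡ s
∈-subsets⇒∣∣ {zero}  {zero}  (here refl) = refl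
∈-subsets⇒∣∣ {suc n} {zero}  p∈ with ∈-map⁻ (outside ∷_) p∈
... | q , q∈ , refl = ∈-subsets⇒∣∣ q∈
∈-subsets⇒∣∣ {suc n} {suc s} p∈ with ∈-++⁻ (List.map (inside ∷_) (subsets n s)) p∈
... | inj₁ p∈ˡ with ∈-map⁻ (inside ∷_) p∈ˡ
...   | q , q∈ , refl = cong suc (∈-subsets⇒∣∣ q∈)
∈-subsets⇒∣∣ {suc n} {suc s} p∈ | inj₂ p∈ʳ with ∈-map⁻ (outside ∷_) p∈ʳ
...   | q , q∈ , refl = ∈-subsets⇒∣∣ q∈

total-bound : ∀ b c (Es : List (Event L m)) → (∀ {E} → E ∈ Es → weight E * c ≤ b) →
  total Es * c ≤ length Es * b
total-bound b c []       h = z≤n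
total-bound b c (E ∷ Es) h = begin
  (weight E + total Es) * c     ≡⟨ *-distribʳ-+ c (weight E) (total Es) ⟩
  weight E * c + total Es * c   ≤⟨ +-mono-≤ (h (here refl)) (total-bound b c Es (h ∘ there)) ⟩
  b + length Es * b             ∎
  where open ≤-Reasoning

length-cartesianProductWith : ∀ {A B C : Set} (f : A → B → C) xs ys →
  length (List.cartesianProductWith f xs ys) ≡ length xs * length ys
length-cartesianProductWith f []       ys = refl
length-cartesianProductWith f (x ∷ xs) ys =
  trans (List.length-++ (List.map (f x) ys))
        (cong₂ _+_ (List.length-map (f x) ys) (length-cartesianProductWith f xs ys))

confinements : ∀ n m → ℕ → List (Event (n * 4) m)
confinements n m s = List.cartesianProductWith confined (subsets n s) (subsets m (2 * s))

-- Size 0 is left out: its event holds for every function.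
confinements≤ : ℕ → ∀ n m → List (Event (n * 4) m)
confinements≤ zero    n m = []
confinements≤ (suc s) n m = confinements n m (suc s) ++ confinements≤ s n m

∈-confinements≤ : ∀ {s K} {E : Event (n * 4) m} → 0 < s → s ≤ K →
  E ∈ confinements n m s → E ∈ confinements≤ K n m
∈-confinements≤ {s = suc s} {zero}  _ () _
∈-confinements≤ {s = s} {suc K} 0<s s≤K E∈ with m≤n⇒m<n∨m≡n s≤K
... | inj₁ s<K  = ∈-++⁺ʳ _ (∈-confinements≤ 0<s (s≤s⁻¹ s<K) E∈)
... | inj₂ refl = ∈-++⁺ˡ E∈

^-distribʳ-* : ∀ a b s → (a * b) ^ s ≡ a ^ s * b ^ s
^-distribʳ-* a b zero    = refl
^-distribʳ-* a b (suc s) = trans (cong (a * b *_) (^-distribʳ-* a b s)) (eq a b (a ^ s) (b ^ s))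
  where
  eq : ∀ a b x y → a * b * (x * y) ≡ a * x * (b * y)
  eq = solve-∀

-- With γ s ≤ m, a random f confines the slots of some s owners to 2 s values with
-- probability at most 2^{-s}.  Opaque, as otherwise it is unfolded to a unary numeral.
opaque
  γ : ℕ
  γ = 2048

  γ≡2048 : γ ≡ 2048
  γ≡2048 = refl

  2≤γ : 2 ≤ γ
  2≤γ = s≤s (s≤s z≤n)

  γ≢0 : NonZero γ
  γ≢0 = _

module _ (m s : ℕ) (0<s : 0 < s) (γ*s≤m : γ * s ≤ m) where

  private
    n₀ = 4 * m
    N₁ = length (subsets n₀ s)
    N₂ = length (subsets m (2 * s))

    instance
      _ : NonZero s
      _ = >-nonZero 0<s
      _ : NonZero (2 * s)
      _ = m*n≢0 2 s
      _ : NonZero (s ^ s)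
      _ = m^n≢0 s s
      _ : NonZero ((2 * s) ^ (2 * s))
      _ = m^n≢0 (2 * s) (2 * s)
      _ : NonZero m
      _ = >-nonZero (<-≤-trans (≤-trans 0<s (m≤n*m s γ {{γ≢0}})) γ*s≤m)
      _ : NonZero ((m ^ 4) ^ s)
      _ = m^n≢0 (m ^ 4) s {{m^n≢0 m 4}}
      _ : NonZero (s ^ s * (2 * s) ^ (2 * s))
      _ = m*n≢0 (s ^ s) ((2 * s) ^ (2 * s))

    [xy²]^s : ∀ x y → (x * (y * y)) ^ s ≡ x ^ s * y ^ (2 * s)
    [xy²]^s x y = trans (^-distribʳ-* x (y * y) s)
      (cong (x ^ s *_) (trans (cong (λ z → (y * z) ^ s) (sym (*-identityʳ y))) (^-*-assoc y 2 s)))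

  -- With binom(n, s) at most (4n/s)^s, the product binom(4m, s) binom(m, 2s) (2s/m)^(4s) is at most
  -- (1024 s/m)^s, and `γ` is twice 1024.
  confined-pairs : N₁ * N₂ * ((2 * s) ^ 4) ^ s * 2 ^ s ≤ (m ^ 4) ^ s
  confined-pairs = *-cancelʳ-≤ _ _ (s ^ s * (2 * s) ^ (2 * s)) (begin
    N₁ * N₂ * ((2 * s) ^ 4) ^ s * 2 ^ s * (s ^ s * (2 * s) ^ (2 * s))
      ≡⟨ eq₁ N₁ N₂ (((2 * s) ^ 4) ^ s) (2 ^ s) (s ^ s) ((2 * s) ^ (2 * s)) ⟩
    N₁ * s ^ s * (N₂ * (2 * s) ^ (2 * s)) * (((2 * s) ^ 4) ^ s * 2 ^ s)
      ≤⟨ *-monoˡ-≤ (((2 * s) ^ 4) ^ s * 2 ^ s) (*-mono-≤ (length-subsets n₀ s) (length-subsets m (2 * s))) ⟩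
    (4 * n₀) ^ s * (4 * m) ^ (2 * s) * (((2 * s) ^ 4) ^ s * 2 ^ s)
      ≡⟨ cong₂ _*_ ([xy²]^s (4 * n₀) (4 * m)) (^-distribʳ-* ((2 * s) ^ 4) 2 s) ⟨
    (4 * n₀ * (4 * m * (4 * m))) ^ s * ((2 * s) ^ 4 * 2) ^ s
      ≡⟨ ^-distribʳ-* (4 * n₀ * (4 * m * (4 * m))) ((2 * s) ^ 4 * 2) s ⟨
    (4 * n₀ * (4 * m * (4 * m)) * ((2 * s) ^ 4 * 2)) ^ s
      ≡⟨ cong (_^ s) (trans (eq₂ m s) (cong (λ c → 4 * (m * m * m) * (s * s * s) * (c * s)) (sym γ≡2048))) ⟩
    (4 * (m * m * m) * (s * s * s) * (γ * s)) ^ s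
      ≤⟨ ^-monoˡ-≤ s (*-monoʳ-≤ (4 * (m * m * m) * (s * s * s)) γ*s≤m) ⟩
    (4 * (m * m * m) * (s * s * s) * m) ^ s
      ≡⟨ cong (_^ s) (eq₃ m s) ⟩
    (m ^ 4 * (s * (2 * s * (2 * s)))) ^ s
      ≡⟨ ^-distribʳ-* (m ^ 4) (s * (2 * s * (2 * s))) s ⟩
    (m ^ 4) ^ s * (s * (2 * s * (2 * s))) ^ s
      ≡⟨ cong ((m ^ 4) ^ s *_) ([xy²]^s s (2 * s)) ⟩
    (m ^ 4) ^ s * (s ^ s * (2 * s) ^ (2 * s)) ∎)
    where
    open ≤-Reasoning
    eq₁ : ∀ a b c d e f → a * b * c * d * (e * f) ≡ a * e * (b * f) * (c * d)
    eq₁ = solve-∀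
    eq₂ : ∀ m s → 4 * (4 * m) * (4 * m * (4 * m)) * (2 * s * (2 * s * (2 * s * (2 * s * 1))) * 2)
                ≡ 4 * (m * m * m) * (s * s * s) * (2048 * s)
    eq₂ = solve-∀
    eq₃ : ∀ m s → 4 * (m * m * m) * (s * s * s) * m ≡ m * (m * (m * (m * 1))) * (s * (2 * s * (2 * s)))
    eq₃ = solve-∀

  total-confinements : total (confinements n₀ m s) * 2 ^ s ≤ (m ^ 4) ^ n₀
  total-confinements = *-cancelʳ-≤ _ _ ((m ^ 4) ^ s) (begin
    W * 2 ^ s * (m ^ 4) ^ s                               ≡⟨ eq₁ W (2 ^ s) ((m ^ 4) ^ s) ⟩
    W * (m ^ 4) ^ s * 2 ^ s                               ≤⟨ *-monoˡ-≤ (2 ^ s) (total-bound b _ (confinements n₀ m s) each) ⟩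
    length (confinements n₀ m s) * b * 2 ^ s               ≡⟨ cong (λ x → x * b * 2 ^ s)
                                                               (length-cartesianProductWith confined (subsets n₀ s) (subsets m (2 * s))) ⟩
    N₁ * N₂ * b * 2 ^ s                                   ≡⟨ eq₂ (N₁ * N₂) (((2 * s) ^ 4) ^ s) ((m ^ 4) ^ n₀) (2 ^ s) ⟩
    N₁ * N₂ * ((2 * s) ^ 4) ^ s * 2 ^ s * (m ^ 4) ^ n₀     ≤⟨ *-monoˡ-≤ ((m ^ 4) ^ n₀) confined-pairs ⟩
    (m ^ 4) ^ s * (m ^ 4) ^ n₀                             ≡⟨ *-comm ((m ^ 4) ^ s) _ ⟩
    (m ^ 4) ^ n₀ * (m ^ 4) ^ s                             ∎)
    where
    open ≤-Reasoning
    W = total (confinements n₀ m s)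
    b = ((2 * s) ^ 4) ^ s * (m ^ 4) ^ n₀
    eq₁ : ∀ a b c → a * b * c ≡ a * c * b
    eq₁ = solve-∀
    eq₂ : ∀ a b c d → a * (b * c) * d ≡ a * b * d * c
    eq₂ = solve-∀
    each : ∀ {E} → E ∈ confinements n₀ m s → weight E * (m ^ 4) ^ s ≤ b
    each E∈ with ∈-cartesianProductWith⁻ confined (subsets n₀ s) (subsets m (2 * s)) E∈
    ... | S , T , S∈ , T∈ , refl = ≤-reflexive
      (subst₂ (λ x y → weight (confined S T) * (m ^ 4) ^ x ≡ (y ^ 4) ^ x * (m ^ 4) ^ n₀)
              (∈-subsets⇒∣∣ S∈) (∈-subsets⇒∣∣ T∈) (weight-confined S T))

-- Geometric series: the sizes 1 to `K` together have probability at most 1 - 2^(-K). Adding a term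
-- on the left replaces the subtraction.
total-confinements≤ : ∀ m K → γ * K ≤ m →
  total (confinements≤ K (4 * m) m) * 2 ^ K + (m ^ 4) ^ (4 * m) ≤ 2 ^ K * (m ^ 4) ^ (4 * m)
total-confinements≤ m zero    h = ≤-reflexive (sym (+-identityʳ _))
total-confinements≤ m (suc K) h = begin
  total (confinements n₀ m (suc K) ++ confinements≤ K n₀ m) * 2 ^ suc K + M
    ≡⟨ cong (λ x → x * 2 ^ suc K + M) (trans
          (cong sumᴸ (List.map-++ weight (confinements n₀ m (suc K)) (confinements≤ K n₀ m)))
          (sumᴸ-++ (List.map weight (confinements n₀ m (suc K))) (List.map weight (confinements≤ K n₀ m)))) ⟩
  (W + Ws) * 2 ^ suc K + M              ≡⟨ eq₁ W Ws (2 ^ K) M ⟩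
  W * 2 ^ suc K + (2 * (Ws * 2 ^ K) + M) ≤⟨ +-monoˡ-≤ _ (total-confinements m (suc K) (s≤s z≤n) h) ⟩
  M + (2 * (Ws * 2 ^ K) + M)            ≡⟨ eq₂ M (Ws * 2 ^ K) ⟩
  2 * (Ws * 2 ^ K + M)                  ≤⟨ *-monoʳ-≤ 2 (total-confinements≤ m K (≤-trans (*-monoʳ-≤ γ (n≤1+n K)) h)) ⟩
  2 * (2 ^ K * M)                       ≡⟨ *-assoc 2 (2 ^ K) M ⟨
  2 * 2 ^ K * M                         ∎
  where
  open ≤-Reasoning
  n₀ = 4 * m
  M = (m ^ 4) ^ n₀
  W = total (confinements n₀ m (suc K))
  Ws = total (confinements≤ K n₀ m)
  eq₁ : ∀ a b c d → (a + b) * (2 * c) + d ≡ a * (2 * c) + (2 * (b * c) + d)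
  eq₁ = solve-∀
  eq₂ : ∀ a b → a + (2 * b + a) ≡ 2 * (b + a)
  eq₂ = solve-∀

private instance
  γ-nonZero : NonZero γ
  γ-nonZero = γ≢0

-- Private slots and the matching

owner : ∀ n → Fin (n * 4) → Fin n
owner n = quotient 4

-- Slots of the same owner may share the value: only different owners compete for a cycle edge.
Private : ∀ {n k} → (Fin (n * 4) → Fin k) → (Fin n → Bool) → Fin (n * 4) → Set
Private {n} f p l = p (owner n l) ≡ true × (∀ l′ → p (owner n l′) ≡ true → f l′ ≡ f l → owner n l′ ≡ owner n l)

-- The scale `m` is separate from the number `k` of values, because cutting the fibres changes the
-- latter to 2m but leaves the size threshold m/γ as it is.
Expanding : ∀ {n k} → ℕ → (Fin (n * 4) → Fin k) → Set
Expanding {n} m f = (p : Fin n → Bool) → 0 < card p → γ * card p ≤ m → ∃ (Private f p)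

-- Without a private slot, each value in the image is shared by slots of two different owners, so
-- the 4s slots have at most 2s values.
private-or-confined : ∀ {n m} (f : Fin (n * 4) → Fin m) (p : Fin n → Bool) →
  ∃ (Private f p) ⊎
  (Σ[ q ∈ (Fin m → Bool) ] card q ≤ 2 * card p × (∀ l → p (owner n l) ≡ true → q (f l) ≡ true))
private-or-confined {n} {m} f p = decide (Fin.any? (λ l → (p (owner n l) Bool.≟ true) ×-dec (card (clash l) ≟ 0)))
  where
  clash : Fin (n * 4) → Fin (n * 4) → Bool
  clash l l′ = p (owner n l′) ∧ (f l′ == f l) ∧ not (owner n l′ == owner n l)
  private-l : ∀ l → card (clash l) ≡ 0 → ∀ l′ → p (owner n l′) ≡ true → f l′ ≡ f l → owner n l′ ≡ owner n l
  private-l l none l′ pl′ fl′≡fl with owner n l′ == owner n l in eq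
  ... | true  = ==⇒≡ eq
  ... | false = contradiction none (>⇒≢ (0<card (clash l) {l′}
                  (∧-intro pl′ (∧-intro (≡⇒== fl′≡fl) (cong not eq)))))
  hits : Fin m → Fin (n * 4) → Bool
  hits v l = p (owner n l) ∧ (f l == v)
  hits⇒≡ : ∀ {v l} → hits v l ≡ true → f l ≡ v
  hits⇒≡ {l = l} h = ==⇒≡ (proj₂ (∧-elim (p (owner n l)) h))
  image : Fin m → Bool
  image v = ∃ᵇ (hits v)
  module _ (crowded : ¬ (∃[ l ] (p (owner n l) ≡ true × card (clash l) ≡ 0))) where
    twice : ∀ v → image v ≡ true → 2 ≤ card (hits v)
    twice v iv with ∃ᵇ-elim (hits v) iv
    ... | l , hl with ∧-elim (p (owner n l)) hl
    ...   | pl , fl≡v with 0 <? card (clash l)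
    ...     | no  none = contradiction (l , pl , n≤0⇒n≡0 (≮⇒≥ none)) crowded
    ...     | yes some with card-witness (clash l) some
    ...       | l′ , h with ∧-elim (p (owner n l′)) h
    ...         | pl′ , h′ with ∧-elim (f l′ == f l) h′
    ...           | fl′≡fl , other = 1<card (hits v) distinct hl
                      (∧-intro pl′ (≡⇒== (trans (==⇒≡ fl′≡fl) (==⇒≡ fl≡v))))
      where
      distinct : l ≢ l′
      distinct refl = true≢false other (cong not (≡⇒== {i = owner n l} refl))
    2|image| : card image ≤ 2 * card p
    2|image| = *-cancelˡ-≤ 2 (begin
      2 * card image            ≤⟨ double-counting image (p ∘ owner n) hits 2 1 twice
                                     (λ v l _ h → proj₁ (∧-elim (p (owner n l)) h))
                                     (λ l → card≤1 _ λ v w hv hw →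
                                        trans (sym (hits⇒≡ (proj₂ (∧-elim (image v) hv))))
                                              (hits⇒≡ (proj₂ (∧-elim (image w) hw)))) ⟩
      1 * card (p ∘ owner n)      ≡⟨ *-identityˡ _ ⟩
      card (p ∘ owner n)          ≡⟨ sum-quotient n (𝟙 ∘ p) ⟩
      4 * card p                ≡⟨ *-assoc 2 2 (card p) ⟩
      2 * (2 * card p)          ∎)
      where open ≤-Reasoning
  decide : Dec (∃[ l ] (p (owner n l) ≡ true × card (clash l) ≡ 0)) → _
  decide (yes (l , pl , none)) = inj₁ (l , pl , private-l l none)
  decide (no crowded)          = inj₂ (image , 2|image| crowded , λ l pl →
    ∃ᵇ-intro (hits (f l)) (∧-intro pl (≡⇒== {i = f l} refl)))

expanding-function : ∀ m → 0 < m → Σ[ f ∈ (Fin (4 * m * 4) → Fin m) ] Expanding m f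
expanding-function m 0<m with avoid (4 * m * 4) m (confinements≤ (m / γ) (4 * m) m) bound
  where
  K = m / γ
  M = (m ^ 4) ^ (4 * m)
  W = total (confinements≤ K (4 * m) m)
  instance
    _ : NonZero m
    _ = >-nonZero 0<m
    _ : NonZero (2 ^ K)
    _ = m^n≢0 2 K
  W<M : W * 2 ^ K < M * 2 ^ K
  W<M = begin-strict
    W * 2 ^ K         <⟨ m<m+n _ (m^n>0 (m ^ 4) {{m^n≢0 m 4}} (4 * m)) ⟩
    W * 2 ^ K + M     ≤⟨ total-confinements≤ m K (≤-trans (≤-reflexive (*-comm γ K)) (m/n*n≤m m γ)) ⟩
    2 ^ K * M         ≡⟨ *-comm (2 ^ K) M ⟩
    M * 2 ^ K         ∎
    where open ≤-Reasoning
  bound : W < m ^ (4 * m * 4)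
  bound = subst (W <_) (trans (^-*-assoc m 4 (4 * m)) (cong (m ^_) (*-comm 4 (4 * m))))
                (*-cancelʳ-< (2 ^ K) _ _ W<M)
... | f , avoids = f , expanding
  where
  expanding : Expanding m f
  expanding p 0<s γs≤m with private-or-confined f p
  ... | inj₁ pr = pr
  ... | inj₂ (q , |q|≤2s , confine)
    with superset (tabulate q) (2 * card p) (subst (_≤ 2 * card p) (sym (∣tabulate∣≡card q)) |q|≤2s)
                  (≤-trans (*-monoˡ-≤ (card p) 2≤γ) γs≤m)
  ... | T , T∈ , q⊆T
    with avoids (∈-confinements≤ 0<s s≤K
           (∈-cartesianProductWith⁺ confined
              (subst (λ s → tabulate p ∈ subsets (4 * m) s) (∣tabulate∣≡card p) (∈-subsets (tabulate p))) T∈))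
    where
    s≤K : card p ≤ m / γ
    s≤K = subst (_≤ m / γ) (trans (cong (_/ γ) (*-comm γ (card p))) (m*n/n≡m (card p) γ))
                (/-monoˡ-≤ γ γs≤m)
  ... | l , h with lookup (tabulate p) (quotient {4 * m} 4 l) in eq
  -- A slot whose owner lies outside `p` is unconstrained, so `h` rules that case out.
  ...   | true = true≢false (q⊆T (f l) (trans (Vec.lookup∘tabulate q (f l))
                   (confine l (trans (sym (Vec.lookup∘tabulate p (owner (4 * m) l))) eq)))) h

-- Bounding the fibres

/-mod-injective : ∀ {x y n} .{{_ : NonZero n}} → x / n ≡ y / n → x mod n ≡ y mod n → x ≡ y
/-mod-injective {x} {y} {n} same-quotient h = begin
  x                  ≡⟨ m≡m%n+[m/n]*n x n ⟩
  x % n + x / n * n  ≡⟨ cong₂ (λ r q → r + q * n) same-remainder same-quotient ⟩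
  y % n + y / n * n  ≡⟨ m≡m%n+[m/n]*n y n ⟨
  y                  ∎
  where
  open ≡-Reasoning
  same-remainder : x % n ≡ y % n
  same-remainder = trans (sym (Fin.toℕ-fromℕ< (m%n<n x n))) (trans (cong toℕ h) (Fin.toℕ-fromℕ< (m%n<n y n)))

-- Breaking the fibres of f into blocks of 16: the slots are ranked by their
-- value, and each full block of 16 ranks shifts all later values up by one.
module _ {m : ℕ} (f : Fin (4 * m * 4) → Fin m) where

  private
    opaque
      -- Lexicographic order: by value first, ties broken by the slot itself.
      key : Fin (4 * m * 4) → ℕ
      key l = toℕ (combine (f l) l)

      key-injective : ∀ {l l′} → key l ≡ key l′ → l ≡ l′
      key-injective {l} {l′} h = Fin.combine-injectiveʳ (f l) l (f l′) l′ (Fin.toℕ-injective h)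

      key-mono : ∀ {l l′} → toℕ (f l) < toℕ (f l′) → key l < key l′
      key-mono {l} {l′} = Fin.combine-monoˡ-< l l′

      rank : Fin (4 * m * 4) → ℕ
      rank l = card (λ l′ → key l′ <ᵇ key l)

      rank-mono : ∀ {l l′} → key l < key l′ → rank l < rank l′
      rank-mono {l} {l′} lt = sum-mono-< (λ i → 𝟙-mono (λ h → <⇒<ᵇ≡true (<-trans (<ᵇ≡true⇒< h) lt))) l
        (subst₂ (λ a b → 𝟙 a < 𝟙 b) (sym (¬true⇒false (λ h → <-irrefl refl (<ᵇ≡true⇒< {key l} {key l} h))))
                                    (sym (<⇒<ᵇ≡true lt)) (s≤s z≤n))

      rank-injective : ∀ {l l′} → rank l ≡ rank l′ → l ≡ l′
      rank-injective {l} {l′} h with <-cmp (key l) (key l′)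
      ... | tri< lt _ _ = contradiction h (<⇒≢ (rank-mono lt))
      ... | tri≈ _ eq _ = key-injective eq
      ... | tri> _ _ gt = contradiction h (>⇒≢ (rank-mono gt))

      rank<L : ∀ l → rank l < 4 * m * 4
      rank<L l = subst (rank l <_) (card-const (4 * m * 4))
        (sum-mono-< (λ i → 𝟙≤1 (key i <ᵇ key l)) l
          (subst (λ a → 𝟙 a < 1) (sym (¬true⇒false (λ h → <-irrefl refl (<ᵇ≡true⇒< {key l} {key l} h)))) (s≤s z≤n)))

    rank/16<m : ∀ l → rank l / 16 < m
    rank/16<m l = m<n*o⇒m/o<n (subst (rank l <_) (eq m) (rank<L l))
      where
      eq : ∀ m → 4 * m * 4 ≡ m * 16
      eq = solve-∀

  opaque
    -- The 16m ranks give shifts below m, so the shifted values stay below 2m.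
    block : Fin (4 * m * 4) → Fin (m + m)
    block l = fromℕ< (+-mono-<-≤ (Fin.toℕ<n (f l)) (<⇒≤ (rank/16<m l)))

    toℕ-block : ∀ l → toℕ (block l) ≡ toℕ (f l) + rank l / 16
    toℕ-block l = Fin.toℕ-fromℕ< _

  private
    block-mono : ∀ {l l′} → toℕ (f l) < toℕ (f l′) → toℕ (block l) < toℕ (block l′)
    block-mono {l} {l′} lt = subst₂ _<_ (sym (toℕ-block l)) (sym (toℕ-block l′))
      (+-mono-<-≤ lt (/-monoˡ-≤ 16 (<⇒≤ (rank-mono (key-mono lt)))))

  -- The shift grows with the rank, so slots with different values stay apart. Hence a slot that is
  -- private for `f` is private for `block f`.
  block-refines : ∀ {l l′} → block l ≡ block l′ → f l ≡ f l′
  block-refines {l} {l′} h with <-cmp (toℕ (f l)) (toℕ (f l′))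
  ... | tri< lt _ _ = contradiction (cong toℕ h) (<⇒≢ (block-mono lt))
  ... | tri≈ _ eq _ = Fin.toℕ-injective eq
  ... | tri> _ _ gt = contradiction (cong toℕ h) (>⇒≢ (block-mono gt))

  -- On a fibre of `block` the value of `f` is constant, hence so is the quotient of the rank by 16,
  -- and the remainder tells the slots apart.
  block-fibre : ∀ e → card (λ l → block l == e) ≤ 16
  block-fibre e = card-injective (λ l → block l == e) (λ (_ : Fin 16) → true) (λ l → rank l mod 16)
    (λ _ _ → refl) injective
    where
    injective : ∀ l l′ → (block l == e) ≡ true → (block l′ == e) ≡ true →
      rank l mod 16 ≡ rank l′ mod 16 → l ≡ l′
    injective l l′ hl hl′ h = rank-injective (/-mod-injective same-quotient h)
      where
      same-block : block l ≡ block l′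
      same-block = trans (==⇒≡ hl) (sym (==⇒≡ hl′))
      same-quotient : rank l / 16 ≡ rank l′ / 16
      same-quotient = +-cancelˡ-≡ (toℕ (f l)) (rank l / 16) (rank l′ / 16) (begin
        toℕ (f l) + rank l / 16    ≡⟨ toℕ-block l ⟨
        toℕ (block l)              ≡⟨ cong toℕ same-block ⟩
        toℕ (block l′)             ≡⟨ toℕ-block l′ ⟩
        toℕ (f l′) + rank l′ / 16  ≡⟨ cong (λ v → toℕ v + rank l′ / 16) (block-refines {l} {l′} same-block) ⟨
        toℕ (f l) + rank l′ / 16   ∎)
        where open ≡-Reasoning

bounded-expanding-function : ∀ m → 0 < m →
  Σ[ g ∈ (Fin (4 * m * 4) → Fin (m + m)) ] Expanding m g × (∀ e → card (λ l → g l == e) ≤ 16)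
bounded-expanding-function m 0<m with expanding-function m 0<m
... | f , f-expanding = block f , expanding , block-fibre f
  where
  expanding : Expanding m (block f)
  expanding p 0<s s≤ with f-expanding p 0<s s≤
  ... | l , pl , pr = l , pl , λ l′ pl′ h → pr l′ pl′ (block-refines f h)

-- Repeatedly remove an owner that has a private slot.
matching : ∀ {n k m} (g : Fin (n * 4) → Fin k) → Expanding m g → (p : Fin n → Bool) → γ * card p ≤ m →
  Σ[ ν ∈ (Fin n → Fin (n * 4)) ] (∀ a → owner n (ν a) ≡ a) ×
    (∀ a a′ → p a ≡ true → p a′ ≡ true → g (ν a) ≡ g (ν a′) → a ≡ a′)
matching {n} {m = m} g g-expanding p = peel (card p) p ≤-refl
  where
  peel : ∀ s p → card p ≤ s → γ * card p ≤ m →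
    Σ[ ν ∈ (Fin n → Fin (n * 4)) ] (∀ a → owner n (ν a) ≡ a) ×
      (∀ a a′ → p a ≡ true → p a′ ≡ true → g (ν a) ≡ g (ν a′) → a ≡ a′)
  peel s p |p|≤s γ|p|≤m with 0 <? card p
  -- Nothing is left to match; every owner gets its first slot as a default.
  ... | no empty = (λ a → combine a zero) , (λ a → cong proj₁ (Fin.remQuot-combine a zero)) ,
                   λ a a′ pa _ _ → contradiction (0<card p pa) empty
  peel zero    p |p|≤s γ|p|≤m | yes 0<|p| = contradiction 0<|p| (≤⇒≯ |p|≤s)
  peel (suc s) p |p|≤s γ|p|≤m | yes 0<|p| with g-expanding p 0<|p| γ|p|≤m
  ... | l , pb , private-l = ν , owner-ν , ν-injective
    where
    b = owner n l
    p′ : Fin n → Bool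
    p′ a = p a ∧ not (a == b)
    |p′|<|p| : card p′ < card p
    |p′|<|p| = sum-mono-< (λ a → 𝟙-mono (λ h → proj₁ (∧-elim (p a) h))) b
      (subst₂ (λ x y → 𝟙 x < 𝟙 y)
        (sym (¬true⇒false (λ h → true≢false (proj₂ (∧-elim (p b) h)) (cong not (≡⇒== {i = b} refl)))))
        (sym pb) (s≤s z≤n))
    rec = peel s p′ (s≤s⁻¹ (≤-trans |p′|<|p| |p|≤s)) (≤-trans (*-monoʳ-≤ γ (<⇒≤ |p′|<|p|)) γ|p|≤m)
    ν : Fin n → Fin (n * 4)
    ν a with a Fin.≟ b
    ... | yes _ = l
    ... | no  _ = proj₁ rec a
    owner-ν : ∀ a → owner n (ν a) ≡ a
    owner-ν a with a Fin.≟ b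
    ... | yes a≡b = sym a≡b
    ... | no  _   = proj₁ (proj₂ rec) a
    others : ∀ {a} → p a ≡ true → a ≢ b → p′ a ≡ true
    others pa a≢b = ∧-intro pa (cong not (¬true⇒false (a≢b ∘ ==⇒≡)))
    -- The slot `l` is private with respect to all of `p`, so no owner matched in the recursion can
    -- take its value.
    clash : ∀ {a} → p a ≡ true → a ≢ b → g (proj₁ rec a) ≢ g l
    clash {a} pa a≢b h = a≢b (trans (sym (proj₁ (proj₂ rec) a))
      (private-l (proj₁ rec a) (subst (λ x → p x ≡ true) (sym (proj₁ (proj₂ rec) a)) pa) h))
    ν-injective : ∀ a a′ → p a ≡ true → p a′ ≡ true → g (ν a) ≡ g (ν a′) → a ≡ a′
    ν-injective a a′ pa pa′ h with a Fin.≟ b | a′ Fin.≟ b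
    ... | yes a≡b | yes a′≡b = trans a≡b (sym a′≡b)
    ... | yes _   | no a′≢b  = contradiction (sym h) (clash pa′ a′≢b)
    ... | no a≢b  | yes _    = contradiction h (clash pa a≢b)
    ... | no a≢b  | no a′≢b  = proj₂ (proj₂ rec) a a′ (others pa a≢b) (others pa′ a′≢b) h

-- Cyclic order

next-cases : (i : Fin (suc n)) → (toℕ i ≡ n × next i ≡ zero) ⊎ (toℕ (next i) ≡ suc (toℕ i))
next-cases {n} i with m≤n⇒m<n∨m≡n (s≤s⁻¹ (Fin.toℕ<n i))
... | inj₁ i<n = inj₂ (trans (Fin.toℕ-fromℕ< (m%n<n (suc (toℕ i)) (suc n))) (m<n⇒m%n≡m (s≤s i<n)))
... | inj₂ i≡n = inj₁ (i≡n , Fin.toℕ-injective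
  (trans (Fin.toℕ-fromℕ< (m%n<n (suc (toℕ i)) (suc n)))
         (trans (cong (λ x → suc x % suc n) i≡n) (n%n≡0 (suc n)))))

next-injective : {i j : Fin (suc n)} → next i ≡ next j → i ≡ j
next-injective {i = i} {j} h with next-cases i | next-cases j
... | inj₁ (i≡n , _)  | inj₁ (j≡n , _)  = Fin.toℕ-injective (trans i≡n (sym j≡n))
... | inj₁ (_ , i′≡0) | inj₂ j′≡        = contradiction (trans (cong toℕ (trans (sym i′≡0) h)) j′≡) λ()
... | inj₂ i′≡        | inj₁ (_ , j′≡0) = contradiction (trans (cong toℕ (trans (sym j′≡0) (sym h))) i′≡) λ()
... | inj₂ i′≡        | inj₂ j′≡        =
  Fin.toℕ-injective (suc-injective (trans (sym i′≡) (trans (cong toℕ h) j′≡)))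

next≢ : 0 < n → (i : Fin (suc n)) → next i ≢ i
next≢ 0<n i h with next-cases i
... | inj₁ (i≡n , i′≡0) = contradiction (trans (sym i≡n) (cong toℕ (trans (sym h) i′≡0))) (>⇒≢ 0<n)
... | inj₂ i′≡          = contradiction (trans (sym i′≡) (cong toℕ h)) 1+n≢n

-- The list holds the inner vertices only, so that consecutive segments share an end and a closed
-- walk starts and ends at the same vertex.
data Chain {A : Set} (P : A → A → Set) : A → List A → A → Set where
  last : ∀ {x y} → P x y → Chain P x [] y
  link : ∀ {x z zs y} → P x z → Chain P z zs y → Chain P x (z ∷ zs) y

chain-++ : ∀ {P : A → A → Set} {x xs y ys z} → Chain P x xs y → Chain P y ys z → Chain P x (xs ++ y ∷ ys) z
chain-++ (last p)   c′ = link p c′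
chain-++ (link p c) c′ = link p (chain-++ c c′)

-- The head `h zero` is kept out of the list because it is the start of the chain; put in front, it
-- completes the concatenation of all segments.
chain-concat : ∀ {k} {P : A → A → Set} (h : Fin (suc k) → A) (t : Fin (suc k) → List A) (y : A) →
  (∀ e e′ → toℕ e′ ≡ suc (toℕ e) → Chain P (h e) (t e) (h e′)) →
  (∀ e → toℕ e ≡ k → Chain P (h e) (t e) y) →
  Chain P (h zero) (t zero ++ List.concat (List.tabulate (λ e → h (suc e) ∷ t (suc e)))) y
chain-concat {k = zero}  h t y _     final =
  subst (λ xs → Chain _ (h zero) xs y) (sym (List.++-identityʳ (t zero))) (final zero refl)
chain-concat {k = suc k} h t y links final = chain-++ (links zero (suc zero) refl)
  (chain-concat (h ∘ suc) (t ∘ suc) y (λ e e′ eq → links (suc e) (suc e′) (cong suc eq))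
                (λ e eq → final (suc e) (cong suc eq)))

chain-cyclic : ∀ {k} {P : A → A → Set} (h : Fin (suc k) → A) (t : Fin (suc k) → List A) →
  (∀ e → Chain P (h e) (t e) (h (next e))) →
  Chain P (h zero) (t zero ++ List.concat (List.tabulate (λ e → h (suc e) ∷ t (suc e)))) (h zero)
chain-cyclic {k = k} {P} h t segments = chain-concat h t (h zero) links final
  where
  links : ∀ e e′ → toℕ e′ ≡ suc (toℕ e) → Chain P (h e) (t e) (h e′)
  links e e′ eq with next-cases e
  ... | inj₁ (e≡k , _) = contradiction (Fin.toℕ<n e′) (≤⇒≯ (≤-reflexive (trans (cong suc (sym e≡k)) (sym eq))))
  ... | inj₂ next≡     = subst (λ v → Chain P (h e) (t e) (h v)) (Fin.toℕ-injective (trans next≡ (sym eq))) (segments e)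
  final : ∀ e → toℕ e ≡ k → Chain P (h e) (t e) (h zero)
  final e e≡k with next-cases e
  ... | inj₁ (_ , next≡0) = subst (λ v → Chain P (h e) (t e) (h v)) next≡0 (segments e)
  ... | inj₂ next≡        = contradiction (Fin.toℕ<n (next e)) (≤⇒≯ (≤-reflexive (sym (trans next≡ (cong suc e≡k)))))

chain-lookup : ∀ {P : A → A → Set} {x xs y} → Chain P x xs y → (i : Fin (suc (length xs))) →
  (toℕ i ≡ length xs → P (List.lookup (x ∷ xs) i) y) ×
  (∀ j → toℕ j ≡ suc (toℕ i) → P (List.lookup (x ∷ xs) i) (List.lookup (x ∷ xs) j))
chain-lookup (last p)   zero    = (λ _ → p) , λ { zero () }
chain-lookup (link p c) zero    = (λ ()) , λ { (suc zero) _ → p ; (suc (suc j)) () ; zero () }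
chain-lookup (link p c) (suc i) = proj₁ rec ∘ suc-injective ,
  λ { (suc j) eq → proj₂ rec j (suc-injective eq) ; zero () }
  where rec = chain-lookup c i

closed-walk : ∀ {k} {P : A → A → Set} {x xs} → Chain P x xs x → length xs ≡ k →
  Σ[ σ ∈ (Fin (suc k) → A) ] (∀ {v} → v ∈ x ∷ xs → ∃[ i ] σ i ≡ v) × (∀ i → P (σ i) (σ (next i)))
closed-walk {P = P} {x} {xs} c refl = List.lookup (x ∷ xs) , (λ v∈ → Any.index v∈ , sym (lookup-index v∈)) , consecutive
  where
  consecutive : ∀ i → P (List.lookup (x ∷ xs) i) (List.lookup (x ∷ xs) (next i))
  consecutive i with next-cases i
  ... | inj₁ (i≡k , next≡0) = subst (λ j → P (List.lookup (x ∷ xs) i) (List.lookup (x ∷ xs) j)) (sym next≡0)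
                                    (proj₁ (chain-lookup c i) i≡k)
  ... | inj₂ next≡          = proj₂ (chain-lookup c i) (next i) next≡

-- Lets a closed walk of the right length be recognised as a Hamiltonian cycle by checking only that
-- every vertex occurs.
surjective⇒injective : (f : Fin n → Fin n) → (∀ y → ∃[ x ] f x ≡ y) → ∀ i j → f i ≡ f j → i ≡ j
surjective⇒injective {n} f surj = injective
  where
  f⁻¹ = proj₁ ∘ surj
  ff⁻¹ : ∀ y → f (f⁻¹ y) ≡ y
  ff⁻¹ = proj₂ ∘ surj
  avoids-u : Fin n → Fin n → Bool
  avoids-u u x = not (x == u)
  -- f⁻¹ would otherwise inject Fin n into the complement of u.
  f⁻¹f : ∀ u → f⁻¹ (f u) ≡ u
  f⁻¹f u with f⁻¹ (f u) Fin.≟ u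
  ... | yes eq = eq
  ... | no  f⁻¹fu≢u = contradiction
    (subst₂ _≤_ (card-const n) refl
      (card-injective (λ _ → true) (avoids-u u) f⁻¹
        (λ y _ → cong not (¬true⇒false λ h → f⁻¹fu≢u
                   (trans (cong (f⁻¹ ∘ f) (sym (==⇒≡ h))) (trans (cong f⁻¹ (ff⁻¹ y)) (==⇒≡ h)))))
        (λ y y′ _ _ h → trans (sym (ff⁻¹ y)) (trans (cong f h) (ff⁻¹ y′)))))
    (<⇒≱ (subst (card (avoids-u u) <_) (card-const n)
       (sum-mono-< (λ x → 𝟙≤1 (avoids-u u x)) u
          (subst (λ b → 𝟙 b < 1) (sym (cong not (≡⇒== {i = u} refl))) (s≤s z≤n)))))
  injective : ∀ i j → f i ≡ f j → i ≡ j
  injective i j h = trans (sym (f⁻¹f i)) (trans (cong f⁻¹ h) (f⁻¹f j))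

-- Cardinalities over disjoint unions, lists and slots

card-split : ∀ a {b} (p : Fin (a + b) → Bool) →
  card p ≡ card (λ i → p (i Fin.↑ˡ b)) + card (λ j → p (a Fin.↑ʳ j))
card-split zero    p = refl
card-split (suc a) p = trans (cong (𝟙 (p zero) +_) (card-split a (p ∘ suc))) (sym (+-assoc (𝟙 (p zero)) _ _))

sumᴸ-tabulate : (f : Fin n → ℕ) → sumᴸ (List.tabulate f) ≡ sum f
sumᴸ-tabulate {zero}  f = refl
sumᴸ-tabulate {suc n} f = cong (f zero +_) (sumᴸ-tabulate (f ∘ suc))

sumᴸ-allFin : (f : Fin n → ℕ) → sumᴸ (List.map f (List.allFin n)) ≡ sum f
sumᴸ-allFin f = trans (cong sumᴸ (List.map-tabulate id f)) (sumᴸ-tabulate f)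

card-≡ˡ≤1 : (j : Fin n) → card (λ i → i == j) ≤ 1
card-≡ˡ≤1 j = card≤1 (_== j) λ i i′ h h′ → trans (==⇒≡ h) (sym (==⇒≡ h′))

card-≡ʳ≤1 : (j : Fin n) → card (λ i → j == i) ≤ 1
card-≡ʳ≤1 j = card≤1 (j ==_) λ i i′ h h′ → trans (sym (==⇒≡ h)) (==⇒≡ h′)

card-owner : (a : Fin n) → card (λ l → owner n l == a) ≤ 4
card-owner {n} a = ≤-trans (≤-reflexive (sum-quotient n (λ i → 𝟙 (i == a)))) (*-monoʳ-≤ 4 (card-≡ˡ≤1 a))

-- The vertices are a cycle b₀, …, b_k followed by n independent vertices, and
-- the slot l joins its owner to the two ends of the cycle edge b_e b_{e+1}, e = g l.
module Construction (n k : ℕ) (0<k : 0 < k) (g : Fin (n * 4) → Fin (suc k)) where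

  Vertex : Set
  Vertex = Fin (suc k + n)

  cyc : Fin (suc k) → Vertex
  cyc b = b Fin.↑ˡ n

  ind : Fin n → Vertex
  ind a = suc k Fin.↑ʳ a

  split : Vertex → Fin (suc k) ⊎ Fin n
  split = Fin.splitAt (suc k)

  split-cyc : ∀ b → split (cyc b) ≡ inj₁ b
  split-cyc b = Fin.splitAt-↑ˡ (suc k) b n

  split-ind : ∀ a → split (ind a) ≡ inj₂ a
  split-ind a = Fin.splitAt-↑ʳ (suc k) n a

  ends : Fin (n * 4) → Fin (suc k) → Bool
  ends l b = (g l == b) ∨ (next (g l) == b)

  joins : Fin n → Fin (suc k) → Fin (n * 4) → Bool
  joins a b l = (owner n l == a) ∧ ends l b

  touches : Fin n → Fin (suc k) → Bool
  touches a b = ∃ᵇ (joins a b)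

  _~_ : Fin (suc k) ⊎ Fin n → Fin (suc k) ⊎ Fin n → Bool
  inj₁ b ~ inj₁ b′ = (next b == b′) ∨ (next b′ == b)
  inj₁ b ~ inj₂ a  = touches a b
  inj₂ a ~ inj₁ b  = touches a b
  inj₂ _ ~ inj₂ _  = false

  graph : Graph
  graph = record
    { order  = suc k + n
    ; adj    = λ v w → split v ~ split w
    ; irrefl = λ v → ~-irrefl (split v)
    ; sym    = λ v w → ~-sym (split v) (split w)
    }
    where
    ~-irrefl : ∀ s → s ~ s ≡ false
    ~-irrefl (inj₁ b) = ¬true⇒false λ h → case (∨-elim (next b == b) h)
      where
      case : (next b == b) ≡ true ⊎ (next b == b) ≡ true → _
      case (inj₁ h) = next≢ 0<k b (==⇒≡ h)
      case (inj₂ h) = next≢ 0<k b (==⇒≡ h)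
    ~-irrefl (inj₂ a) = refl
    ~-sym : ∀ s t → s ~ t ≡ t ~ s
    ~-sym (inj₁ b) (inj₁ b′) = ∨-comm (next b == b′) (next b′ == b)
    ~-sym (inj₁ b) (inj₂ a)  = refl
    ~-sym (inj₂ a) (inj₁ b)  = refl
    ~-sym (inj₂ a) (inj₂ a′) = refl

  module _ (fibre : ∀ e → card (λ l → g l == e) ≤ 16) where

    private
      card-ends : ∀ b → card (λ l → ends l b) ≤ 32
      card-ends b = ≤-trans (card-∨ (λ l → g l == b) (λ l → next (g l) == b)) (+-mono-≤ (fibre b) preceding)
        where
        -- All these slots share one value, the cycle edge that ends at `b`, because `next` is
        -- injective.
        preceding : card (λ l → next (g l) == b) ≤ 16
        preceding with 0 <? card (λ l → next (g l) == b)
        ... | no  empty = ≤-trans (≮⇒≥ empty) z≤n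
        ... | yes some with card-witness (λ l → next (g l) == b) some
        ...   | l , hl = ≤-trans (card-mono (λ l → next (g l) == b) (λ l′ → g l′ == g l)
            (λ l′ hl′ → ≡⇒== (next-injective (trans (==⇒≡ hl′) (sym (==⇒≡ hl)))))) (fibre (g l))

      row : ∀ a → card (touches a) ≤ 8
      row a = subst (_≤ 8) (*-identityˡ _) (≤-trans
        (double-counting (touches a) (λ l → owner n l == a) (joins a) 1 2
          (λ b h → let l , hl = ∃ᵇ-elim (joins a b) h in 0<card (joins a b) hl)
          (λ b l _ h → proj₁ (∧-elim (owner n l == a) h))
          (λ l → ≤-trans (card-mono (λ b → touches a b ∧ joins a b l) (ends l)
                   (λ b h → proj₂ (∧-elim (owner n l == a) (proj₂ (∧-elim (touches a b) h)))))
                 (≤-trans (card-∨ (g l ==_) (next (g l) ==_)) (+-mono-≤ (card-≡ʳ≤1 (g l)) (card-≡ʳ≤1 (next (g l)))))))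
        (*-monoʳ-≤ 2 (card-owner a)))

      column : ∀ b → card (λ a → touches a b) ≤ 32
      column b = subst (_≤ 32) (*-identityˡ _) (≤-trans
        (double-counting (λ a → touches a b) (λ l → ends l b) (λ a → joins a b) 1 1
          (λ a h → let l , hl = ∃ᵇ-elim (joins a b) h in 0<card (joins a b) hl)
          (λ a l _ h → proj₂ (∧-elim (owner n l == a) h))
          (λ l → ≤-trans (card-mono (λ a → touches a b ∧ joins a b l) (owner n l ==_)
                   (λ a h → proj₁ (∧-elim (owner n l == a) (proj₂ (∧-elim (touches a b) h)))))
                         (card-≡ʳ≤1 (owner n l))))
        (≤-trans (≤-reflexive (*-identityˡ _)) (card-ends b)))

      -- A cycle vertex has 2 neighbours on the cycle and at most 32 off it; an independent vertex
      -- has at most two for each of its four slots.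
      valency : ∀ s → card (λ b → s ~ inj₁ b) + card (λ a → s ~ inj₂ a) ≤ 34
      valency (inj₁ b) = +-mono-≤ (≤-trans (card-∨ (next b ==_) (λ b′ → next b′ == b))
        (+-mono-≤ (card-≡ʳ≤1 (next b)) (card≤1 (λ b′ → next b′ == b) λ i j hi hj →
          next-injective (trans (==⇒≡ hi) (sym (==⇒≡ hj)))))) (column b)
      valency (inj₂ a) = ≤-trans (+-mono-≤ (row a) (≤-reflexive (card-∅ {n} (λ _ → refl)))) (m≤m+n 8 26)

    card-adj : ∀ v → card (adj graph v) ≤ 34
    card-adj v = subst (_≤ 34) (sym (trans (card-split (suc k) (adj graph v))
      (cong₂ _+_ (card-cong (λ b → cong (split v ~_) (split-cyc b))) (card-cong (λ a → cong (split v ~_) (split-ind a))))))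
      (valency (split v))

  -- Distance from Hamiltonicity

  independent : Vertex → Bool
  independent v = [ (λ _ → false) , (λ _ → true) ]′ (split v)

  card-independent : card independent ≡ n
  card-independent = trans (card-split (suc k) independent) (trans (cong₂ _+_
    (card-∅ (λ b → cong [ (λ _ → false) , (λ _ → true) ]′ (split-cyc b)))
    (card-cong (λ a → cong [ (λ _ → false) , (λ _ → true) ]′ (split-ind a)))) (card-const n))

  card-dependent : card (not ∘ independent) ≡ suc k
  card-dependent = trans (card-split (suc k) (not ∘ independent)) (trans (cong₂ _+_
    (trans (card-cong (λ b → cong (not ∘ [ (λ _ → false) , (λ _ → true) ]′) (split-cyc b))) (card-const (suc k)))
    (card-∅ (λ a → cong (not ∘ [ (λ _ → false) , (λ _ → true) ]′) (split-ind a)))) (+-identityʳ _))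

  independent⇒nonadjacent : ∀ v w → independent v ≡ true → independent w ≡ true → adj graph v w ≡ false
  independent⇒nonadjacent v w hv hw with split v | split w
  ... | inj₂ _ | inj₂ _ = refl

  -- Every step of a Hamiltonian cycle between two independent vertices uses a
  -- pair of E, and each of the other independent vertices is followed by one of
  -- the suc k cycle vertices.
  edits-bound : (E : PairSet (suc k + n)) → Hamiltonian (Defs.flip graph E) → n ≤ 2 * size E + suc k
  edits-bound E (_ , σ , walk) = begin
    n                                       ≡⟨ card-independent ⟨
    card independent                        ≤⟨ card-injective independent (independent ∘ to) from
                                                 (λ v hv → trans (cong independent (to∘from v)) hv)
                                                 (λ v w _ _ h → trans (sym (to∘from v)) (trans (cong to h) (to∘from w))) ⟩
    card (independent ∘ to)                 ≤⟨ card-mono (independent ∘ to)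
                                                 (λ i → inner i ∨ not (independent (to (next i)))) split-step ⟩
    card (λ i → inner i ∨ not (independent (to (next i))))
                                            ≤⟨ card-∨ inner (λ i → not (independent (to (next i)))) ⟩
    card inner + card (λ i → not (independent (to (next i))))
                                            ≤⟨ +-mono-≤ inner≤ (card-injective
                                                 (λ i → not (independent (to (next i)))) (not ∘ independent) (to ∘ next)
                                                 (λ _ h → h)
                                                 (λ i j _ _ h → next-injective (Bijection.injective σ h))) ⟩
    2 * size E + card (not ∘ independent)   ≡⟨ cong (2 * size E +_) card-dependent ⟩
    2 * size E + suc k                      ∎
    where
    open ≤-Reasoning
    to = Bijection.to σ
    from : Vertex → Vertex
    from v = proj₁ (Bijection.surjective σ v)
    to∘from : ∀ v → to (from v) ≡ v
    to∘from v = proj₂ (Bijection.surjective σ v) refl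
    inner : Vertex → Bool
    inner i = independent (to i) ∧ independent (to (next i))
    split-step : ∀ i → independent (to i) ≡ true → inner i ∨ not (independent (to (next i))) ≡ true
    split-step i hi rewrite hi with independent (to (next i))
    ... | true  = refl
    ... | false = refl
    inner⇒mem : ∀ i → inner i ≡ true → mem E (to i) (to (next i)) ≡ true
    inner⇒mem i h with ∧-elim (independent (to i)) h
    ... | h₁ , h₂ with adj graph (to i) (to (next i)) | independent⇒nonadjacent (to i) (to (next i)) h₁ h₂ | walk i
    ...   | false | refl | w = w
    upper lower : Vertex → Vertex → Bool
    upper v w = mem E v w ∧ (toℕ v <ᵇ toℕ w)
    lower v w = mem E v w ∧ (toℕ w <ᵇ toℕ v)
    size≡ : size E ≡ sum (λ v → card (upper v))
    size≡ = trans (sumᴸ-allFin (λ v → ∣ tabulate (upper v) ∣)) (sum-cong-≗ (λ v → ∣tabulate∣≡card (upper v)))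
    upper-or-lower : ∀ v w → 𝟙 (mem E v w) ≤ 𝟙 (upper v w) + 𝟙 (lower v w)
    upper-or-lower v w with mem E v w in eq
    ... | false = z≤n
    ... | true with <-cmp (toℕ v) (toℕ w)
    ...   | tri< lt _ _ = ≤-trans (≤-reflexive (sym (cong 𝟙 (<⇒<ᵇ≡true lt)))) (m≤m+n _ _)
    ...   | tri> _ _ gt = ≤-trans (≤-reflexive (sym (cong 𝟙 (<⇒<ᵇ≡true gt)))) (m≤n+m _ _)
    ...   | tri≈ _ v≡w _ = true≢false (trans (cong (mem E v) (Fin.toℕ-injective v≡w)) eq) (irreflE E v)
    -- Each such step is charged to its start, which is covered by a pair of `E`; the number of
    -- covered vertices is at most the degree sum 2|E|.
    inner≤ : card inner ≤ 2 * size E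
    inner≤ = begin
      card inner                            ≤⟨ card-injective inner (∃ᵇ ∘ mem E) to
                                                 (λ i h → ∃ᵇ-intro (mem E (to i)) (inner⇒mem i h))
                                                 (λ i j _ _ h → Bijection.injective σ h) ⟩
      card (∃ᵇ ∘ mem E)                     ≤⟨ sum-mono (λ v → 𝟙∃ᵇ (mem E v)) ⟩
      sum (λ v → card (mem E v))            ≤⟨ sum-mono (λ v → ≤-trans (sum-mono (upper-or-lower v))
                                                 (≤-reflexive (∑-distrib-+ (𝟙 ∘ upper v) (𝟙 ∘ lower v)))) ⟩
      sum (λ v → card (upper v) + card (lower v))
                                            ≡⟨ ∑-distrib-+ (λ v → card (upper v)) (λ v → card (lower v)) ⟩
      sum (λ v → card (upper v)) + sum (λ v → card (lower v))
                                            ≡⟨ cong (sum (λ v → card (upper v)) +_) (trans (∑-comm (λ v w → 𝟙 (lower v w)))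
                                                 (sum-cong-≗ (λ w → card-cong (λ v → cong (_∧ (toℕ w <ᵇ toℕ v)) (symE E v w))))) ⟩
      sum (λ v → card (upper v)) + sum (λ v → card (upper v))
                                            ≡⟨ cong₂ _+_ size≡ (trans (+-identityʳ _) size≡) ⟨
      2 * size E                            ∎
      where
      𝟙∃ᵇ : ∀ {n} (p : Fin n → Bool) → 𝟙 (∃ᵇ p) ≤ card p
      𝟙∃ᵇ p with card p
      ... | zero  = z≤n
      ... | suc _ = s≤s z≤n

-- Closed neighbourhoods and adding a Hamiltonian cycle

any-intro : ∀ {A : Set} (p : A → Bool) {x xs} → x ∈ xs → p x ≡ true → any p xs ≡ true
any-intro p (here refl) px = ∨-introˡ px
any-intro p {xs = y ∷ _} (there x∈) px = ∨-introʳ {p y} (any-intro p x∈ px)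

any-elim : ∀ {A : Set} (p : A → Bool) xs → any p xs ≡ true → ∃[ x ] p x ≡ true
any-elim p (x ∷ xs) h with ∨-elim (p x) h
... | inj₁ px = x , px
... | inj₂ h′ = any-elim p xs h′

module _ (G : Graph) (S : Subset (order G)) where

  near : Fin (order G) → Bool
  near = lookup (Defs.N G S)

  private
    near≡ : ∀ v → near v ≡ lookup S v ∨ any (λ w → lookup S w ∧ adj G w v) (List.allFin (order G))
    near≡ = Vec.lookup∘tabulate _

  S⊆near : ∀ {v} → lookup S v ≡ true → near v ≡ true
  S⊆near {v} h = trans (near≡ v) (∨-introˡ h)

  neighbour⇒near : ∀ {v w} → lookup S w ≡ true → adj G w v ≡ true → near v ≡ true
  neighbour⇒near {v} {w} hw e = trans (near≡ v) (∨-introʳ {lookup S v}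
    (any-intro (λ w → lookup S w ∧ adj G w v) (∈-allFin w) (∧-intro hw e)))

  near-elim : ∀ {v} → near v ≡ true → lookup S v ≡ true ⊎ (∃[ w ] lookup S w ≡ true × adj G w v ≡ true)
  near-elim {v} h with ∨-elim (lookup S v) (trans (sym (near≡ v)) h)
  ... | inj₁ hv = inj₁ hv
  ... | inj₂ h′ with any-elim (λ w → lookup S w ∧ adj G w v) (List.allFin (order G)) h′
  ...   | w , hw = inj₂ (w , ∧-elim (lookup S w) hw)

  -- Joining such a pair changes neither N(S) nor the graph induced on it.
  Free : Fin (order G) → Fin (order G) → Set
  Free v w = (near v ≡ false × lookup S w ≡ false) ⊎ (near w ≡ false × lookup S v ≡ false)

  Free-sym : ∀ {v w} → Free v w → Free w v
  Free-sym (inj₁ h) = inj₂ h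
  Free-sym (inj₂ h) = inj₁ h

-- The graph is given by its adjacency on `Fin (suc k)`, so that its order is literally a successor,
-- as `next` and `HamCycleOn` require.
module Extension {k : ℕ} (a : Fin (suc k) → Fin (suc k) → Bool)
  (a-irrefl : ∀ v → a v v ≡ false) (a-sym : ∀ v w → a v w ≡ a w v) (0<k : 0 < k)
  (σ : Fin (suc k) → Fin (suc k)) (σ-surjective : ∀ v → ∃[ i ] σ i ≡ v) where

  G : Graph
  G = record { order = suc k ; adj = a ; irrefl = a-irrefl ; sym = a-sym }

  σ-injective : ∀ i j → σ i ≡ σ j → i ≡ j
  σ-injective = surjective⇒injective σ σ-surjective

  steps : Fin (suc k) → Fin (suc k) → Fin (suc k) → Bool
  steps v w i = (σ i == v) ∧ (σ (next i) == w)

  step : Fin (suc k) → Fin (suc k) → Bool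
  step v w = ∃ᵇ (steps v w)

  step-elim : ∀ {v w} → step v w ≡ true → ∃[ i ] σ i ≡ v × σ (next i) ≡ w
  step-elim {v} {w} h with ∃ᵇ-elim (steps v w) h
  ... | i , hi with ∧-elim (σ i == v) hi
  ...   | h₁ , h₂ = i , ==⇒≡ h₁ , ==⇒≡ h₂

  step-next : ∀ i → step (σ i) (σ (next i)) ≡ true
  step-next i = ∃ᵇ-intro (steps (σ i) (σ (next i))) {i} (∧-intro (≡⇒== refl) (≡⇒== refl))

  step-irrefl : ∀ v → step v v ≡ false
  step-irrefl v = ¬true⇒false λ h →
    let i , h₁ , h₂ = step-elim h in next≢ 0<k i (σ-injective (next i) i (trans h₂ (sym h₁)))

  card-step : ∀ v → card (step v) ≤ 1
  card-step v = card≤1 (step v) λ w w′ h h′ →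
    let i , h₁ , h₂ = step-elim h
        j , h₃ , h₄ = step-elim h′
    in trans (sym h₂) (trans (cong (σ ∘ next) (σ-injective i j (trans h₁ (sym h₃)))) h₄)

  card-step′ : ∀ w → card (λ v → step v w) ≤ 1
  card-step′ w = card≤1 (λ v → step v w) λ v v′ h h′ →
    let i , h₁ , h₂ = step-elim h
        j , h₃ , h₄ = step-elim h′
    in trans (sym h₁) (trans (cong σ (next-injective (σ-injective (next i) (next j) (trans h₂ (sym h₄))))) h₃)

  H : Graph
  H = record
    { order  = suc k
    ; adj    = λ v w → a v w ∨ (step v w ∨ step w v)
    ; irrefl = λ v → cong₂ _∨_ (a-irrefl v) (cong₂ _∨_ (step-irrefl v) (step-irrefl v))
    ; sym    = λ v w → cong₂ _∨_ (a-sym v w) (∨-comm (step v w) (step w v))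
    }

  H-degree : ∀ d → (∀ v → card (a v) ≤ d) → InC (d + 2) H
  H-degree d bound v = ≤-trans (≤-reflexive (∣tabulate∣≡card (adj H v)))
    (≤-trans (card-∨ (a v) (λ w → step v w ∨ step w v))
      (+-mono-≤ (bound v) (≤-trans (card-∨ (step v) (λ w → step w v)) (+-mono-≤ (card-step v) (card-step′ v)))))

  H-hamiltonian : 2 ≤ k → Hamiltonian H
  H-hamiltonian 2≤k = s≤s 2≤k ,
    mk⤖ ((λ {i} {j} → σ-injective i j) , λ v → proj₁ (σ-surjective v) , λ { refl → proj₂ (σ-surjective v) }) ,
    λ i → ∨-introʳ {a (σ i) (σ (next i))} (∨-introˡ (step-next i))

  module _ (S : Subset (suc k)) (links : ∀ i → a (σ i) (σ (next i)) ≡ true ⊎ Free G S (σ i) (σ (next i))) where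

    private
      adjacent-or-free : ∀ v w → adj H v w ≡ true → a v w ≡ true ⊎ Free G S v w
      adjacent-or-free v w h with ∨-elim (a v w) h
      ... | inj₁ e = inj₁ e
      ... | inj₂ h′ with ∨-elim (step v w) h′
      ...   | inj₁ s with step-elim s
      ...     | i , refl , refl = links i
      adjacent-or-free v w h | inj₂ h′ | inj₂ s with step-elim s
      ...     | i , refl , refl with links i
      ...       | inj₁ e = inj₁ (trans (a-sym v w) e)
      ...       | inj₂ f = inj₂ (Free-sym G S f)

      ¬free : ∀ {v w} → near G S v ≡ true → near G S w ≡ true → ¬ Free G S v w
      ¬free hv hw (inj₁ (¬hv , _)) = true≢false hv ¬hv
      ¬free hv hw (inj₂ (¬hw , _)) = true≢false hw ¬hw

      near-H⇒near-G : ∀ {v} → near H S v ≡ true → near G S v ≡ true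
      near-H⇒near-G {v} h with near-elim H S {v} h
      ... | inj₁ hv = S⊆near G S hv
      ... | inj₂ (w , hw , e) with adjacent-or-free w v e
      ...   | inj₁ e′ = neighbour⇒near G S hw e′
      ...   | inj₂ (inj₁ (¬nw , _)) = true≢false (S⊆near G S hw) ¬nw
      ...   | inj₂ (inj₂ (_ , ¬hw)) = true≢false hw ¬hw

      near-G⇒near-H : ∀ {v} → near G S v ≡ true → near H S v ≡ true
      near-G⇒near-H {v} h with near-elim G S {v} h
      ... | inj₁ hv           = S⊆near H S hv
      ... | inj₂ (w , hw , e) = neighbour⇒near H S hw (∨-introˡ e)

    -- The identity map with `T = S`: every edge of `H` that is not in `G` is free, so it leaves the
    -- neighbourhood and its induced graph unchanged.
    local-isomorphism : IsoNbhd G S H S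
    local-isomorphism = mk⤖ {to = to} (injective , surjective) , induced , λ x → mk⇔ id id
      where
      to : Vtx G (Defs.N G S) → Vtx H (Defs.N H S)
      to (v , h) = v , Vec.lookup⇒[]= v _ (near-G⇒near-H {v} (Vec.[]=⇒lookup h))
      Vtx-≡ : ∀ {K} {X : Subset (order K)} {x y : Vtx K X} → proj₁ x ≡ proj₁ y → x ≡ y
      Vtx-≡ {x = v , h} {_ , h′} refl = cong (v ,_) ([]=-irrelevant h h′)
      injective : ∀ {x y} → to x ≡ to y → x ≡ y
      injective eq = Vtx-≡ {G} (cong proj₁ eq)
      surjective : ∀ y → ∃[ x ] (∀ {z} → z ≡ x → to z ≡ y)
      surjective (v , h) = (v , Vec.lookup⇒[]= v _ (near-H⇒near-G {v} (Vec.[]=⇒lookup h))) , λ { refl → Vtx-≡ {H} refl }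
      induced : ∀ x y → a (proj₁ x) (proj₁ y) ≡ adj H (proj₁ x) (proj₁ y)
      induced (v , hv) (w , hw) = bool-ext ∨-introˡ λ h → back (adjacent-or-free v w h)
        where
        back : a v w ≡ true ⊎ Free G S v w → a v w ≡ true
        back (inj₁ e) = e
        back (inj₂ f) = ⊥-elim (¬free (Vec.[]=⇒lookup hv) (Vec.[]=⇒lookup hw) f)

-- Building the tour for a given small set

select : (Fin n → Bool) → List (Fin n)
select {zero}  p = []
select {suc n} p = if p zero then zero ∷ List.map suc (select (p ∘ suc)) else List.map suc (select (p ∘ suc))

length-select : (p : Fin n → Bool) → length (select p) ≡ card p
length-select {zero}  p = refl
length-select {suc n} p with p zero
... | true  = cong suc (trans (List.length-map suc (select (p ∘ suc))) (length-select (p ∘ suc)))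
... | false = trans (List.length-map suc (select (p ∘ suc))) (length-select (p ∘ suc))

∈-select⁺ : (p : Fin n → Bool) {i : Fin n} → p i ≡ true → i ∈ select p
∈-select⁺ p {zero}  pi rewrite pi = here refl
∈-select⁺ p {suc i} pi with p zero
... | true  = there (∈-map⁺ suc (∈-select⁺ (p ∘ suc) pi))
... | false = ∈-map⁺ suc (∈-select⁺ (p ∘ suc) pi)

∈-select⁻ : (p : Fin n → Bool) {i : Fin n} → i ∈ select p → p i ≡ true
∈-select⁻ {suc n} p i∈ with p zero in eq
∈-select⁻ {suc n} p (here refl) | true = eq
∈-select⁻ {suc n} p (there i∈)  | true with ∈-map⁻ suc i∈
... | j , j∈ , refl = ∈-select⁻ (p ∘ suc) j∈
∈-select⁻ {suc n} p i∈ | false with ∈-map⁻ suc i∈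
... | j , j∈ , refl = ∈-select⁻ (p ∘ suc) j∈

length-concat-tabulate : (f : Fin n → List A) → length (List.concat (List.tabulate f)) ≡ sum (length ∘ f)
length-concat-tabulate {zero}  f = refl
length-concat-tabulate {suc n} f =
  trans (List.length-++ (f zero)) (cong (length (f zero) +_) (length-concat-tabulate (f ∘ suc)))

card<n⇒∃false : (p : Fin n → Bool) → card p < n → ∃[ i ] p i ≡ false
card<n⇒∃false {n} p h with Fin.any? (λ i → p i Bool.≟ false)
... | yes found = found
... | no  none  = contradiction h (≤⇒≯ (subst (_≤ card p) (card-const n)
                    (card-mono (λ _ → true) p (λ i _ → Bool.¬-not (λ h → none (i , h))))))

-- Serves the edge into which all the remaining vertices go: there any two consecutive vertices are
-- linked, whatever their order.
chain-complete : ∀ {P : A → A → Set} {x y} zs → P x y → (∀ {z} → z ∈ zs → P x z) → (∀ {z} → z ∈ zs → P z y) →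
  (∀ {z z′} → z ∈ zs → z′ ∈ zs → P z z′) → Chain P x zs y
chain-complete []       xy xz zy zz = last xy
chain-complete (z ∷ zs) xy xz zy zz = link (xz (here refl))
  (chain-complete zs (zy (here refl)) (λ z∈ → zz (here refl) (there z∈)) (zy ∘ there)
    (λ z∈ z′∈ → zz (there z∈) (there z′∈)))

-- Each independent vertex near S is inserted into the cycle edge matched to it,
-- and all the others are inserted into one edge e₀ that is away from S.
module Local (n k m : ℕ) (0<k : 0 < k) (2≤k+n : 2 ≤ k + n) (g : Fin (n * 4) → Fin (suc k))
  (fibre : ∀ e → card (λ l → g l == e) ≤ 16) (expanding : Expanding {n} m g)
  (S : Subset (suc k + n)) (γ*35s≤m : γ * (35 * card (lookup S)) ≤ m) (37s≤k : 37 * card (lookup S) ≤ k) where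

  open Construction n k 0<k g

  private
    inS : Vertex → Bool
    inS = lookup S

    nearS : Fin n → Bool
    nearS a = near graph S (ind a)

    ind-injective : ∀ {a a′} → ind a ≡ ind a′ → a ≡ a′
    ind-injective = Fin.↑ʳ-injective (suc k) _ _

    cyc-injective : ∀ {b b′} → cyc b ≡ cyc b′ → b ≡ b′
    cyc-injective = Fin.↑ˡ-injective n _ _

    -- A member of `S` accounts for itself and at most 34 neighbours.
    card-nearS : card nearS ≤ 35 * card inS
    card-nearS = subst (_≤ 35 * card inS) (*-identityˡ _) (double-counting nearS (inS) within 1 35 covered
      (λ a v _ h → proj₁ (∧-elim (inS v) h)) few)
      where
      within : Fin n → Vertex → Bool
      within a v = inS v ∧ ((ind a == v) ∨ adj graph v (ind a))
      covered : ∀ a → nearS a ≡ true → 1 ≤ card (within a)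
      covered a h with near-elim graph S {ind a} h
      ... | inj₁ ha           = 0<card (within a) {ind a} (∧-intro ha (∨-introˡ (≡⇒== refl)))
      ... | inj₂ (w , hw , e) = 0<card (within a) {w} (∧-intro hw (∨-introʳ {ind a == w} e))
      few : ∀ v → card (λ a → nearS a ∧ within a v) ≤ 35
      few v = begin
        card (λ a → nearS a ∧ within a v)
          ≤⟨ card-mono (λ a → nearS a ∧ within a v) (λ a → (ind a == v) ∨ adj graph v (ind a))
               (λ a h → proj₂ (∧-elim (inS v) (proj₂ (∧-elim (nearS a) h)))) ⟩
        card (λ a → (ind a == v) ∨ adj graph v (ind a))
          ≤⟨ card-∨ (λ a → ind a == v) (λ a → adj graph v (ind a)) ⟩
        card (λ a → ind a == v) + card (λ a → adj graph v (ind a))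
          ≤⟨ +-mono-≤ (card≤1 (λ a → ind a == v) (λ a a′ h h′ → ind-injective (trans (==⇒≡ h) (sym (==⇒≡ h′)))))
               (≤-trans (m≤n+m _ (card (λ b → adj graph v (cyc b))))
               (≤-trans (≤-reflexive (sym (card-split (suc k) (adj graph v)))) (card-adj fibre v))) ⟩
        35 ∎
        where open ≤-Reasoning

    opaque
      matched : Σ[ ν ∈ (Fin n → Fin (n * 4)) ] (∀ a → owner n (ν a) ≡ a) ×
        (∀ a a′ → nearS a ≡ true → nearS a′ ≡ true → g (ν a) ≡ g (ν a′) → a ≡ a′)
      matched = matching g expanding nearS (≤-trans (*-monoʳ-≤ γ card-nearS) γ*35s≤m)

    ν : Fin n → Fin (n * 4)
    ν = proj₁ matched

    owner-ν : ∀ a → owner n (ν a) ≡ a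
    owner-ν = proj₁ (proj₂ matched)

    ν-injective : ∀ a a′ → nearS a ≡ true → nearS a′ ≡ true → g (ν a) ≡ g (ν a′) → a ≡ a′
    ν-injective = proj₂ (proj₂ matched)

    uses : Fin (suc k) → Fin n → Bool
    uses e a = nearS a ∧ (g (ν a) == e)

    -- The edges that cannot take the far vertices: a near vertex is already matched into them, or
    -- an end lies in `S`.
    bad : Fin (suc k) → Bool
    bad e = ∃ᵇ (uses e) ∨ (inS (cyc e) ∨ inS (cyc (next e)))

    -- At most 35|S| edges are used by the matching, and each member of `S` is the first end of at
    -- most one edge and the second end of at most one.
    card-bad : card bad ≤ k
    card-bad = begin
      card bad
        ≤⟨ card-∨ (∃ᵇ ∘ uses) (λ e → inS (cyc e) ∨ inS (cyc (next e))) ⟩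
      card (∃ᵇ ∘ uses) + card (λ e → inS (cyc e) ∨ inS (cyc (next e)))
        ≤⟨ +-mono-≤ (subst₂ _≤_ (*-identityˡ _) (*-identityˡ _)
             (double-counting (∃ᵇ ∘ uses) nearS uses 1 1
               (λ e h → let a , ha = ∃ᵇ-elim (uses e) h in 0<card (uses e) ha)
               (λ e a _ h → proj₁ (∧-elim (nearS a) h))
               (λ a → card≤1 (λ e → ∃ᵇ (uses e) ∧ uses e a) λ e e′ h h′ →
                  trans (sym (==⇒≡ (proj₂ (∧-elim (nearS a) (proj₂ (∧-elim (∃ᵇ (uses e)) h))))))
                        (==⇒≡ (proj₂ (∧-elim (nearS a) (proj₂ (∧-elim (∃ᵇ (uses e′)) h′))))))))
             (card-∨ (inS ∘ cyc) (inS ∘ cyc ∘ next)) ⟩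
      card nearS + (card (inS ∘ cyc) + card (inS ∘ cyc ∘ next))
        ≤⟨ +-mono-≤ card-nearS (+-mono-≤
             (card-injective (inS ∘ cyc) inS cyc (λ _ h → h) (λ _ _ _ _ → cyc-injective))
             (card-injective (inS ∘ cyc ∘ next) inS (cyc ∘ next) (λ _ h → h)
               (λ _ _ _ _ h → next-injective (cyc-injective h)))) ⟩
      35 * card inS + (card inS + card inS)
        ≡⟨ eq (card inS) ⟩
      37 * card inS
        ≤⟨ 37s≤k ⟩
      k ∎
      where
      open ≤-Reasoning
      eq : ∀ s → 35 * s + (s + s) ≡ 37 * s
      eq = solve-∀

    opaque
      good : ∃[ e ] bad e ≡ false
      good = card<n⇒∃false bad (s≤s card-bad)

    e₀ : Fin (suc k)
    e₀ = proj₁ good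

    ¬bad-e₀ : ¬ (bad e₀ ≡ true)
    ¬bad-e₀ h = true≢false h (proj₂ good)

    e₀∉S : inS (cyc e₀) ≡ false
    e₀∉S = ¬true⇒false λ h → ¬bad-e₀ (∨-introʳ {∃ᵇ (uses e₀)} (∨-introˡ h))

    next-e₀∉S : inS (cyc (next e₀)) ≡ false
    next-e₀∉S = ¬true⇒false λ h → ¬bad-e₀ (∨-introʳ {∃ᵇ (uses e₀)} (∨-introʳ {inS (cyc e₀)} h))

    place : Fin n → Fin (suc k)
    place a = if nearS a then g (ν a) else e₀

    placed : Fin (suc k) → List (Fin n)
    placed e = select (λ a → place a == e)

    place-e₀ : ∀ {a} → place a ≡ e₀ → nearS a ≡ false
    place-e₀ {a} h with nearS a in eq
    ... | false = refl
    ... | true  = ⊥-elim (¬bad-e₀ (∨-introˡ (∃ᵇ-intro (uses e₀) {a} (∧-intro eq (≡⇒== h)))))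

    place-other : ∀ {a e} → place a ≡ e → e ≢ e₀ → nearS a ≡ true × g (ν a) ≡ e
    place-other {a} h e≢e₀ with nearS a
    ... | true  = refl , h
    ... | false = contradiction (sym h) e≢e₀

    Link : Vertex → Vertex → Set
    Link v w = adj graph v w ≡ true ⊎ Free graph S v w

    cyc-link : ∀ e → Link (cyc e) (cyc (next e))
    cyc-link e = inj₁ (trans (cong₂ _~_ (split-cyc e) (split-cyc (next e))) (∨-introˡ (≡⇒== refl)))

    touches-link : ∀ a b → touches a b ≡ true → Link (cyc b) (ind a) × Link (ind a) (cyc b)
    touches-link a b h = inj₁ (trans (cong₂ _~_ (split-cyc b) (split-ind a)) h) ,
                         inj₁ (trans (cong₂ _~_ (split-ind a) (split-cyc b)) h)

    joins-ends : ∀ a b → ends (ν a) b ≡ true → touches a b ≡ true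
    joins-ends a b h = ∃ᵇ-intro (joins a b) {ν a} (∧-intro (≡⇒== (owner-ν a)) h)

    far⇒∉S : ∀ {a} → nearS a ≡ false → inS (ind a) ≡ false
    far⇒∉S {a} h = ¬true⇒false λ h′ → true≢false (S⊆near graph S {ind a} h′) h

    segment-other : ∀ {e} → e ≢ e₀ → ∀ xs → length xs ≤ 1 → (∀ {a} → a ∈ xs → place a ≡ e) →
      Chain Link (cyc e) (List.map ind xs) (cyc (next e))
    segment-other {e} _ [] _ _ = last (cyc-link e)
    segment-other {e} e≢e₀ (a ∷ []) _ h with place-other (h (here refl)) e≢e₀
    ... | _ , refl = link (proj₁ (touches-link a e (joins-ends a e (∨-introˡ (≡⇒== refl)))))
                    (last (proj₂ (touches-link a (next e) (joins-ends a (next e)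
                      (∨-introʳ {g (ν a) == next e} (≡⇒== refl))))))
    segment-other _ (_ ∷ _ ∷ _) (s≤s ()) _

    segment : ∀ e → Chain Link (cyc e) (List.map ind (placed e)) (cyc (next e))
    segment e with e Fin.≟ e₀
    -- Away from `e₀` only near vertices are placed, and the matching puts at most one of them into
    -- each edge.
    ... | no e≢e₀ = segment-other e≢e₀ (placed e)
      (≤-trans (≤-reflexive (length-select (λ a → place a == e)))
        (card≤1 (λ a → place a == e) λ a a′ h h′ →
          let na  , ga  = place-other (==⇒≡ h) e≢e₀
              na′ , ga′ = place-other (==⇒≡ h′) e≢e₀
          in ν-injective a a′ na na′ (trans ga (sym ga′))))
      (λ a∈ → ==⇒≡ (∈-select⁻ (λ a → place a == e) a∈))
    -- Only far vertices are placed here. The ends of `e₀` may be near `S`; it is enough that they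
    -- lie outside `S` for every link to a far vertex to be free.
    ... | yes refl = chain-complete (List.map ind (placed e₀)) (cyc-link e₀)
      (λ z∈ → let z-far , _ = far z∈ in inj₂ (inj₂ (z-far , e₀∉S)))
      (λ z∈ → let z-far , _ = far z∈ in inj₂ (inj₁ (z-far , next-e₀∉S)))
      (λ z∈ z′∈ → let z-far , _ = far z∈ ; _ , z′∉S = far z′∈ in inj₂ (inj₁ (z-far , z′∉S)))
      where
      far : ∀ {z} → z ∈ List.map ind (placed e₀) → near graph S z ≡ false × inS z ≡ false
      far z∈ with ∈-map⁻ ind z∈
      ... | a , a∈ , refl = let a-far = place-e₀ {a} (==⇒≡ (∈-select⁻ (λ a → place a == e₀) a∈)) in a-far , far⇒∉S a-far

    segments : Fin (suc k) → List Vertex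
    segments e = cyc e ∷ List.map ind (placed e)

    tour : List Vertex
    tour = List.concat (List.tabulate segments)

    ∈-tour : ∀ v → v ∈ tour
    ∈-tour v = subst (_∈ tour) (Fin.join-splitAt (suc k) n v) (visited (split v))
      where
      visited : ∀ s → Fin.join (suc k) n s ∈ tour
      visited (inj₁ b) = ∈-concat⁺′ (here refl) (∈-tabulate⁺ {f = segments} b)
      visited (inj₂ a) = ∈-concat⁺′ (there (∈-map⁺ ind (∈-select⁺ (λ a′ → place a′ == place a) (≡⇒== refl))))
                                    (∈-tabulate⁺ {f = segments} (place a))

    -- Every independent vertex is placed in exactly one edge, so the exchanged double sum counts it
    -- once.
    length-tour : length tour ≡ suc k + n
    length-tour = begin
      length tour                                          ≡⟨ length-concat-tabulate segments ⟩
      sum (λ e → suc (length (List.map ind (placed e))))   ≡⟨ sum-cong-≗ (λ e → cong suc (trans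
                                                                (List.length-map ind (placed e)) (length-select (λ a → place a == e)))) ⟩
      sum (λ e → 1 + card (λ a → place a == e))            ≡⟨ ∑-distrib-+ (λ _ → 1) (λ e → card (λ a → place a == e)) ⟩
      sum {suc k} (λ _ → 1) + sum (λ e → card (λ a → place a == e))
        ≡⟨ cong₂ _+_ (card-const (suc k)) (∑-comm (λ e a → 𝟙 (place a == e))) ⟩
      suc k + sum (λ a → card (λ e → place a == e))
        ≡⟨ cong (suc k +_) (trans (sum-cong-≗ (λ a →
             ≤-antisym (card-≡ʳ≤1 (place a)) (0<card (place a ==_) (≡⇒== refl)))) (card-const n)) ⟩
      suc k + n                                            ∎
      where open ≡-Reasoning

    walk = closed-walk (chain-cyclic cyc (List.map ind ∘ placed) segment) (suc-injective length-tour)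

    module E = Extension (adj graph) (irrefl graph) (Graph.sym graph) (<-≤-trans (s≤s z≤n) (≤-trans (n≤1+n 1) 2≤k+n))
                 (proj₁ walk) (λ v → proj₁ (proj₂ walk) (∈-tour v))

  locally-hamiltonian : Σ[ H ∈ Graph ] Σ[ eq ∈ order H ≡ order graph ]
    (InC 36 H × Hamiltonian H × Σ[ T ∈ Subset (order H) ] IsoNbhd graph S H T)
  locally-hamiltonian = E.H , refl , E.H-degree 34 (card-adj fibre) , E.H-hamiltonian 2≤k+n ,
                        S , E.local-isomorphism S (proj₂ (proj₂ walk))

-- From rational to natural inequalities

reciprocal : ℕ → ℚ
reciprocal k = mkℚ (pos 1) k (1-coprimeTo (suc k))

0<reciprocal : ∀ k → 0ℚ ℚ.< reciprocal k
0<reciprocal k = *<* (+<+ (s≤s z≤n))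

reciprocal<1 : ∀ k → reciprocal (suc k) ℚ.< 1ℚ
reciprocal<1 k = *<* (+<+ (s≤s (s≤s z≤n)))

-- Division normalises by a gcd, which is stuck on a variable; the explicit fraction exposes
-- numerator and denominator.
ℕtoℚ≡mkℚ : ∀ x → ℕtoℚ x ≡ mkℚ (pos x) 0 (Coprimality.sym (1-coprimeTo x))
ℕtoℚ≡mkℚ x = ℚ.fromℚᵘ-toℚᵘ (mkℚ (pos x) 0 (Coprimality.sym (1-coprimeTo x)))

ℕtoℚ-* : ∀ x y → ℕtoℚ x ℚ.* ℕtoℚ y ≡ ℕtoℚ (x * y)
ℕtoℚ-* x y = trans (cong₂ ℚ._*_ (ℕtoℚ≡mkℚ x) (ℕtoℚ≡mkℚ y)) (cong (ℚ._/ 1) (sym (ℤ.pos-* x y)))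

≤reciprocal* : ∀ k x y → ℕtoℚ x ℚ.≤ reciprocal k ℚ.* ℕtoℚ y → suc k * x ≤ y
≤reciprocal* k x y h = ℤ.drop‿+≤+ (subst₂ ℤ._≤_ left right (ℚᵘ.drop-*≤*
  (ℚᵘ.≤-respʳ-≃ (ℚ.toℚᵘ-homo-* (reciprocal k) (mkℚ (pos y) 0 (Coprimality.sym (1-coprimeTo y))))
    (ℚ.toℚᵘ-mono-≤ (subst₂ (λ p q → p ℚ.≤ reciprocal k ℚ.* q) (ℕtoℚ≡mkℚ x) (ℕtoℚ≡mkℚ y) h)))))
  where
  left : pos x ℤ.* pos (suc k * 1) ≡ pos (suc k * x)
  left = trans (sym (ℤ.pos-* x (suc k * 1))) (cong pos (trans (cong (x *_) (*-identityʳ (suc k))) (*-comm x (suc k))))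
  right : pos 1 ℤ.* pos y ℤ.* pos 1 ≡ pos y
  right = trans (ℤ.*-identityʳ _) (ℤ.*-identityˡ _)

-- δ = ε = 1 / (2 + κ), where 216 m = 36 · 6 m is the degree bound times the order.
opaque
  unfolding γ

  κ : ℕ
  κ = 442366

  2+κ≡γ*216 : 2 + κ ≡ γ * 216
  2+κ≡γ*216 = refl

-- The sequence of graphs

module _ (N : ℕ) where

  private
    M = suc N
    -- Chosen so that `suc K` is `M + M` by computation, the number of values of the bounded
    -- expanding function.
    K = N + suc N

    g-data = bounded-expanding-function M (s≤s z≤n)
    g = proj₁ g-data

    0<k : 0 < K
    0<k = ≤-trans (s≤s z≤n) (m≤n+m (suc N) N)

  open Construction (4 * M) K 0<k g

  farGraph : Graph
  farGraph = graph

  private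
    order≡ : order farGraph ≡ 6 * M
    order≡ = eq M
      where
      eq : ∀ M → M + M + 4 * M ≡ 6 * M
      eq = solve-∀

  farGraph-InC : InC 36 farGraph
  farGraph-InC v = ≤-trans (≤-reflexive (∣tabulate∣≡card (adj graph v)))
    (≤-trans (card-adj (proj₂ (proj₂ g-data)) v) (m≤m+n 34 2))

  farGraph-locallyHam : LocallyHam (reciprocal (suc κ)) 36 farGraph
  farGraph-locallyHam S h = Local.locally-hamiltonian
    (4 * M) K M 0<k 2≤k+n g (proj₂ (proj₂ g-data)) (proj₁ (proj₂ g-data)) S
    -- The common constant `γ * 216` provides 36 where the near vertices need 35.
    (≤-trans (*-monoʳ-≤ γ (*-monoˡ-≤ s (m≤m+n 35 1))) γ*36s≤m)
    (≤-trans 37s≤m (m≤n+m (suc N) N))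
    where
    s = card (lookup S)
    2≤k+n : 2 ≤ K + 4 * M
    2≤k+n = ≤-trans (≤-trans (m≤m+n 2 2) (m≤m*n 4 M)) (m≤n+m (4 * M) K)
    γ*36s≤m : γ * (36 * s) ≤ M
    γ*36s≤m = *-cancelˡ-≤ 6 (begin
      6 * (γ * (36 * s))  ≡⟨ eq γ s ⟩
      γ * 216 * s         ≡⟨ cong (_* s) 2+κ≡γ*216 ⟨
      (2 + κ) * s         ≡⟨ cong ((2 + κ) *_) (∣∣≡card S) ⟨
      (2 + κ) * ∣ S ∣     ≤⟨ ≤reciprocal* (suc κ) ∣ S ∣ (order farGraph) h ⟩
      order farGraph      ≡⟨ order≡ ⟩
      6 * M               ∎)
      where
      open ≤-Reasoning
      eq : ∀ γ s → 6 * (γ * (36 * s)) ≡ γ * 216 * s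
      eq = solve-∀
    -- Here 37 is at most 72 = 2 · 36, and 2 is at most `γ`.
    37s≤m : 37 * s ≤ M
    37s≤m = ≤-trans (≤-trans (*-monoˡ-≤ s (m≤m+n 37 35))
      (≤-trans (≤-reflexive (*-assoc 2 36 s)) (*-monoˡ-≤ (36 * s) 2≤γ))) γ*36s≤m

  -- By `edits-bound`, Hamiltonicity would need 2|E| to be at least 4M - 2M = 2M, whereas the choice
  -- of ε gives 2|E| at most M.
  farGraph-far : FarFromHam (reciprocal (suc κ)) 36 farGraph
  farGraph-far E h ham = <-irrefl refl (begin-strict
    4 * M               ≤⟨ edits-bound E ham ⟩
    2 * size E + suc K  ≤⟨ +-monoˡ-≤ (suc K) (≤-trans (*-monoˡ-≤ (size E) 2≤γ) γ*size≤m) ⟩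
    M + (M + M)         <⟨ m<n+m (M + (M + M)) (s≤s z≤n) ⟩
    M + (M + (M + M))   ≡⟨ eq M ⟩
    4 * M               ∎)
    where
    open ≤-Reasoning
    eq : ∀ M → M + (M + (M + M)) ≡ 4 * M
    eq = solve-∀
    γ*size≤m : γ * size E ≤ M
    γ*size≤m = *-cancelˡ-≤ 216 (begin
      216 * (γ * size E)       ≡⟨ eq₁ γ (size E) ⟩
      γ * 216 * size E         ≡⟨ cong (_* size E) 2+κ≡γ*216 ⟨
      (2 + κ) * size E         ≤⟨ ≤reciprocal* (suc κ) (size E) (36 * order farGraph)
                                    (subst (ℕtoℚ (size E) ℚ.≤_) (trans
                                      (ℚ.*-assoc (reciprocal (suc κ)) (ℕtoℚ 36) (ℕtoℚ (order farGraph)))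
                                      (cong (reciprocal (suc κ) ℚ.*_) (ℕtoℚ-* 36 (order farGraph)))) h) ⟩
      36 * order farGraph      ≡⟨ cong (36 *_) order≡ ⟩
      36 * (6 * M)             ≡⟨ *-assoc 36 6 M ⟨
      216 * M                  ∎)
      where
      eq₁ : ∀ γ s → 216 * (γ * s) ≡ γ * 216 * s
      eq₁ = solve-∀

farGraph-increasing : ∀ N → order (farGraph N) < order (farGraph (suc N))
farGraph-increasing N = +-mono-<-≤ (+-mono-<-≤ (n<1+n (suc N)) (n≤1+n (suc N))) (*-monoʳ-≤ 4 (n≤1+n (suc N)))

theorem5p3 : Σ[ d ∈ ℕ ] Σ[ δ ∈ ℚ ] Σ[ ε ∈ ℚ ]
    (0ℚ ℚ.< δ × δ ℚ.< 1ℚ × 0ℚ ℚ.< ε × ε ℚ.< 1ℚ ×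
    Σ[ G ∈ (ℕ → Graph) ]
    ((∀ N → order (G N) < order (G (suc N))) ×
    (∀ N → InC d (G N) × LocallyHam δ d (G N) × FarFromHam ε d (G N))))
theorem5p3 = 36 , reciprocal (suc κ) , reciprocal (suc κ) ,
  0<reciprocal (suc κ) , reciprocal<1 κ , 0<reciprocal (suc κ) , reciprocal<1 κ ,
  farGraph , farGraph-increasing , λ N → farGraph-InC N , farGraph-locallyHam N , farGraph-far N
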